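{- A minor-closed class $\mathcal{G}$ of graphs has bounded layered pathwidth (i.e. there is a constant $c$ with $\operatorname{lpw}(G)\le c$ for all $G\in\mathcal{G}$) if and only if some apex-forest is not in $\mathcal{G}$.
   Context: Graphs are finite and simple. A class of graphs is minor-closed if every minor of a graph in the class is in the class. A path decomposition of a graph $G$ is a sequence $(B_1,\dots,B_n)$ of subsets of $V(G)$ (bags) such that every edge has both endpoints in some bag and, for every vertex $v$, the set of indices $i$ with $v\in B_i$ is a non-empty interval. A layering of $G$ is a partition $(V_0,V_1,\dots,V_t)$ of $V(G)$ such that for every edge $vw$ with $v\in V_i$, $w\in V_j$ we have $|i-j|\le 1$. The layered width of a path decomposition is the minimum integer $\ell$ such that, for some layering of $G$, each bag contains at most $\ell$ vertices of each layer. The layered pathwidth $\operatorname{lpw}(G)$ is the minimum layered width of a path decomposition of $G$. A graph $G$ is an apex-forest if $G-v$ is a forest for some vertex $v$. -}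

module Defs where

open import Data.Nat using (ℕ; zero; suc; _+_; _≤_)
open import Data.Fin using (Fin; zero; suc; toℕ; inject₁; fromℕ)
open import Data.Bool using (Bool; true; false; if_then_else_; _∧_)
open import Data.List using (List; map; allFin)
open import Data.Nat.ListAction using (sum)
open import Data.Product using (Σ; _×_; _,_; ∃)
open import Relation.Binary.PropositionalEquality using (_≡_; _≢_)
open import Relation.Nullary using (¬_)
open import Function.Definitions using (Injective)

record Graph : Set where
  field
    n     : ℕ
    adj   : Fin n → Fin n → Bool
    sym   : ∀ u v → adj u v ≡ adj v u
    loopless : ∀ v → adj v v ≡ false
open Graph public

V : Graph → Set
V G = Fin (n G)

Adj : (G : Graph) → V G → V G → Set
Adj G u v = adj G u v ≡ true

-- Minors, via models: each vertex of G is assigned to at most one branch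
-- set (φ g ≡ just h means g lies in the branch set of h).

open import Data.Maybe using (Maybe; just; nothing)

data Reach (G : Graph) (S : V G → Set) : V G → V G → Set where
  here : ∀ {u} → S u → Reach G S u u
  step : ∀ {u w v} → S u → Adj G u w → Reach G S w v → Reach G S u v

record MinorModel (H G : Graph) : Set where
  field
    φ         : V G → Maybe (V H)
    nonempty  : ∀ h → ∃ λ g → φ g ≡ just h
    connected : ∀ h g g' → φ g ≡ just h → φ g' ≡ just h →
                Reach G (λ x → φ x ≡ just h) g g'
    edges     : ∀ h h' → Adj H h h' →
                ∃ λ g → ∃ λ g' → φ g ≡ just h × φ g' ≡ just h' × Adj G g g'

_≼_ : Graph → Graph → Set
H ≼ G = MinorModel H G

MinorClosed : (Graph → Set) → Set
MinorClosed 𝒢 = ∀ G H → 𝒢 G → H ≼ G → 𝒢 H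

record PathDecomposition (G : Graph) : Set where
  field
    k        : ℕ
    bag      : Fin k → V G → Bool
    edgeCov  : ∀ u v → Adj G u v → ∃ λ i → bag i u ≡ true × bag i v ≡ true
    vertCov  : ∀ v → ∃ λ i → bag i v ≡ true
    interval : ∀ v (i j l : Fin k) → toℕ i ≤ toℕ j → toℕ j ≤ toℕ l →
               bag i v ≡ true → bag l v ≡ true → bag j v ≡ true
open PathDecomposition public

-- Layering: vertex v lies in layer L v; edges join equal or consecutive layers.
-- (Equivalent to a partition (V_0,…,V_t) with possibly empty parts.)
IsLayering : (G : Graph) → (V G → ℕ) → Set
IsLayering G L = ∀ u v → Adj G u v → L u ≤ suc (L v) × L v ≤ suc (L u)

count : ∀ {m} → (Fin m → Bool) → ℕ
count {m} p = sum (map (λ v → if p v then 1 else 0) (allFin m))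

open import Data.Nat using (_≡ᵇ_)

LayeredWidthAtMost : (G : Graph) → PathDecomposition G → ℕ → Set
LayeredWidthAtMost G P ℓ =
  Σ (V G → ℕ) λ L → IsLayering G L ×
    (∀ (i : Fin (k P)) (j : ℕ) → count (λ v → bag P i v ∧ (L v ≡ᵇ j)) ≤ ℓ)

LpwAtMost : Graph → ℕ → Set
LpwAtMost G c = Σ (PathDecomposition G) λ P → LayeredWidthAtMost G P c

BoundedLayeredPathwidth : (Graph → Set) → Set
BoundedLayeredPathwidth 𝒢 = ∃ λ c → ∀ G → 𝒢 G → LpwAtMost G c

record Cycle (G : Graph) : Set where
  field
    m      : ℕ
    vert   : Fin (suc (suc (suc m))) → V G
    inj    : Injective _≡_ _≡_ vert
    consec : ∀ (i : Fin (suc (suc m))) → Adj G (vert (inject₁ i)) (vert (suc i))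
    close  : Adj G (vert (fromℕ (suc (suc m)))) (vert zero)
open Cycle public

IsApexForest : Graph → Set
IsApexForest G = Σ (V G) λ a → ¬ (Σ (Cycle G) λ C → ∀ i → vert C i ≢ a)

{-# OPTIONS --safe #-}
module Submission where

-- Excluded ⇒ bounded.  Let H - h₀ be a forest and G have no H-minor.  Given a vertex a outside D such
-- that every vertex outside D with a neighbour in D is connected to a outside D, a forest model in D
-- all of whose branch sets meet ∂ D would extend to an H-minor, with the part around a as apex.
-- A rooted version of Diestel's proof of the excluded forest theorem then covers ∂ D by the cores of
-- a path decomposition of D, the bags of which have bounded cores but may have large private parts.
-- The core becomes one layer, and the private parts are decomposed recursively in the layers below.
--
-- Bounded ⇒ excluded.  In a layering of a ternary tree with an apex at most three layers are
-- nonempty, so layered pathwidth c would bound the pathwidth of ternary trees by 3c.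

open import Defs
open import Data.Bool using (Bool; true; false; _∧_; _∨_; if_then_else_)
import Data.Bool.Properties as Bool
open import Data.Empty using (⊥-elim)
open import Data.Fin using (Fin; zero; suc; toℕ; fromℕ; fromℕ<; inject₁)
import Data.Fin.Properties as Fin
open import Data.Fin.Properties using (any?; all?)
open import Data.Fin.Subset
  using (Subset; ⊤; ⊥; ⁅_⁆; ∁; _∈_; _∉_; _⊆_; _⊂_; _∪_; _∩_; _─_; _-_; ∣_∣; Nonempty)
open import Data.Fin.Subset.Properties
open import Data.Fin.Relation.Unary.Top using (view; ‵fromℕ; ‵inject₁)
import Data.List as List
import Data.List.Properties as List
open import Data.Maybe using (Maybe; just; nothing)
open import Data.Maybe.Properties using (just-injective)
open import Data.Nat.ListAction using (sum)
open import Data.Nat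
  using (ℕ; zero; suc; _+_; _*_; _∸_; _⊔_; _≡ᵇ_; _≤_; _<_; z≤n; s≤s; s≤s⁻¹; _≤?_; _<?_)
open import Data.Nat.DivMod using (_/_; _%_; m%n<n; m≡m%n+[m/n]*n; m/n≤m; +-distrib-/-∣ʳ; m*n/n≡m; m<n⇒m/n≡0)
open import Data.Nat.Divisibility using (n∣m*n)
open import Data.Nat.Properties renaming (_≟_ to _≟ℕ_)
open import Data.Product using (Σ; ∃; _×_; _,_; proj₁; proj₂)
open import Data.Sum using (_⊎_; inj₁; inj₂; [_,_]′)
open import Data.Vec using (Vec; []; _∷_; tabulate; lookup)
open import Data.Vec.Properties using ([]=⇒lookup; lookup⇒[]=; lookup∘tabulate)
open import Function using (_∘_; id; case_of_)
open import Function.Bundles using (_⇔_; mk⇔; Equivalence)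
open import Relation.Binary.PropositionalEquality
  using (_≡_; _≢_; refl; trans; cong; subst; subst₂) renaming (sym to ≡-sym)
open import Relation.Binary.Definitions using (tri<; tri≈; tri>)
open import Relation.Nullary using (¬_; Dec; yes; no; does; contradiction)
open import Relation.Nullary.Decidable
  using (_×-dec_; _⊎-dec_; _→-dec_; ¬?; dec-true; decidable-stable)
open import Relation.Unary using (Decidable)

-- Subsets of a finite set

-- The constant is three times the order of `H`: the core vertices in a bag come from two
-- consecutive boundaries and from the newly covered part of `∂ G D`, each with at most `n H`
-- vertices. It does not grow with the depth of the recursion, because every level puts its cores
-- into a layer of their own and the private parts of one level sit in disjoint blocks of bags.
--
-- The recursion needs each private part to inherit the connection to `a`, and this can fail: a
-- private part may separate other vertices of `D` from `a`. Since private parts may be arbitrarily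
-- large, such a part can simply absorb whatever it cuts off. No vertex of `∂ G D` is ever cut off,
-- so the core still covers it.
--
-- In the converse, the tree is ternary because among three subtrees with thick bags one bag lies
-- between the other two; a walk joining those two adds one vertex to it per level.

does⁻ : {A : Set} (A? : Dec A) → does A? ≡ true → A
does⁻ (yes a) _ = a

∈-tabulate⁺ : ∀ {m} (f : Fin m → Bool) {v} → f v ≡ true → v ∈ tabulate f
∈-tabulate⁺ f {v} e = lookup⇒[]= v _ (trans (lookup∘tabulate f v) e)

∈-tabulate⁻ : ∀ {m} (f : Fin m → Bool) {v} → v ∈ tabulate f → f v ≡ true
∈-tabulate⁻ f {v} v∈ = trans (≡-sym (lookup∘tabulate f v)) ([]=⇒lookup v∈)

⟪_⟫ : ∀ {n} {P : Fin n → Set} → Decidable P → Subset n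
⟪ P? ⟫ = tabulate (does ∘ P?)

∈⟪⟫⁺ : ∀ {n} {P : Fin n → Set} (P? : Decidable P) {v} → P v → v ∈ ⟪ P? ⟫
∈⟪⟫⁺ P? {v} Pv = ∈-tabulate⁺ (does ∘ P?) (dec-true (P? v) Pv)

∈⟪⟫⁻ : ∀ {n} {P : Fin n → Set} (P? : Decidable P) {v} → v ∈ ⟪ P? ⟫ → P v
∈⟪⟫⁻ P? {v} v∈ = does⁻ (P? v) (∈-tabulate⁻ (does ∘ P?) v∈)

∣∪∣+∣∩∣ : ∀ {n} (p q : Subset n) → ∣ p ∪ q ∣ + ∣ p ∩ q ∣ ≡ ∣ p ∣ + ∣ q ∣
∣∪∣+∣∩∣ []          []          = refl
∣∪∣+∣∩∣ (true ∷ p)  (true ∷ q)  =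
  cong suc (trans (+-suc _ _) (trans (cong suc (∣∪∣+∣∩∣ p q)) (≡-sym (+-suc _ _))))
∣∪∣+∣∩∣ (true ∷ p)  (false ∷ q) = cong suc (∣∪∣+∣∩∣ p q)
∣∪∣+∣∩∣ (false ∷ p) (true ∷ q)  = trans (cong suc (∣∪∣+∣∩∣ p q)) (≡-sym (+-suc _ _))
∣∪∣+∣∩∣ (false ∷ p) (false ∷ q) = ∣∪∣+∣∩∣ p q

∣∪∣≤ : ∀ {n} (p q : Subset n) → ∣ p ∪ q ∣ ≤ ∣ p ∣ + ∣ q ∣
∣∪∣≤ p q = ≤-trans (m≤m+n _ _) (≤-reflexive (∣∪∣+∣∩∣ p q))

∣∪⁅⁆∣≤ : ∀ {n} (p : Subset n) v → ∣ p ∪ ⁅ v ⁆ ∣ ≤ suc ∣ p ∣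
∣∪⁅⁆∣≤ p v = ≤-trans (∣∪∣≤ p ⁅ v ⁆) (≤-reflexive (trans (cong (∣ p ∣ +_) (∣⁅x⁆∣≡1 v)) (+-comm _ 1)))

⊂-intro : ∀ {n} {p q : Subset n} {v} → p ⊆ q → v ∈ q → v ∉ p → p ⊂ q
⊂-intro p⊆q v∈q v∉p = p⊆q , _ , v∈q , v∉p

⊆-tight : ∀ {n} {p q : Subset n} → p ⊆ q → ∣ q ∣ ≤ ∣ p ∣ → q ⊆ p
⊆-tight {p = p} p⊆q ∣q∣≤∣p∣ {v} v∈q = decidable-stable (v ∈? p)
  λ v∉p → <⇒≱ (p⊂q⇒∣p∣<∣q∣ (⊂-intro p⊆q v∈q v∉p)) ∣q∣≤∣p∣

∪-lub : ∀ {n} {p q r : Subset n} → p ⊆ r → q ⊆ r → p ∪ q ⊆ r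
∪-lub p⊆r q⊆r v∈ = [ p⊆r , q⊆r ]′ (x∈p∪q⁻ _ _ v∈)

⁅⁆⊆ : ∀ {n} {p : Subset n} {v} → v ∈ p → ⁅ v ⁆ ⊆ p
⁅⁆⊆ {p = p} v∈p x∈ = subst (_∈ p) (≡-sym (x∈⁅y⁆⇒x≡y _ x∈)) v∈p

∈-∪⁅⁆ : ∀ {n} (p : Subset n) v → v ∈ p ∪ ⁅ v ⁆
∈-∪⁅⁆ p v = q⊆p∪q p _ (x∈⁅x⁆ v)

∈─⁻ : ∀ {n} (p q : Subset n) {v} → v ∈ p ─ q → v ∈ p × v ∉ q
∈─⁻ (true ∷ p)  (false ∷ q) Data.Vec.here       = Data.Vec.here , λ ()
∈─⁻ (true ∷ p)  (true ∷ q)  {zero} ()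
∈─⁻ (false ∷ p) (true ∷ q)  {zero} ()
∈─⁻ (false ∷ p) (false ∷ q) {zero} ()
∈─⁻ (_ ∷ p)     (_ ∷ q)     (Data.Vec.there v∈) with ∈─⁻ p q v∈
... | v∈p , v∉q = Data.Vec.there v∈p , λ { (Data.Vec.there v∈q) → v∉q v∈q }

∈-⁻ : ∀ {n} (p : Subset n) x {v} → v ∈ p - x → v ∈ p × v ≢ x
∈-⁻ p x v∈ with ∈─⁻ p ⁅ x ⁆ v∈
... | v∈p , v∉ = v∈p , λ { refl → v∉ (x∈⁅x⁆ x) }

∣∅∣≤ : ∀ {n k} {p : Subset n} → ¬ Nonempty p → ∣ p ∣ ≤ k
∣∅∣≤ {n} {k} {p} ¬ne = subst (λ q → ∣ q ∣ ≤ k) (≡-sym (Empty-unique ¬ne))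
                         (subst (_≤ k) (≡-sym (∣⊥∣≡0 n)) z≤n)

minimiser : ∀ {n} {P : Subset n → Set} → Decidable P → (f : Subset n → ℕ) → ∀ X → P X →
            ∃ λ Y → P Y × (∀ Z → P Z → f Y ≤ f Z)
minimiser {P = P} P? f X PX = go (f X) X PX ≤-refl
  where
  go : ∀ fuel X → P X → f X ≤ fuel → ∃ λ Y → P Y × (∀ Z → P Z → f Y ≤ f Z)
  go fuel X PX f≤ with anySubset? (λ Z → P? Z ×-dec f Z <? f X)
  go fuel X PX f≤ | no ¬Z = X , PX , λ Z PZ → ≮⇒≥ λ fZ<fX → ¬Z (Z , PZ , fZ<fX)
  go zero X PX f≤ | yes (Z , PZ , fZ<fX) = ⊥-elim (n≮0 (≤-trans fZ<fX f≤))
  go (suc fuel) X PX f≤ | yes (Z , PZ , fZ<fX) = go fuel Z PZ (s≤s⁻¹ (≤-trans fZ<fX f≤))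

maximal : ∀ {n} {P : Subset n → Set} → Decidable P → ∀ X → P X →
          ∃ λ Y → X ⊆ Y × P Y × (∀ Z → Y ⊂ Z → ¬ P Z)
maximal P? X PX with minimiser (λ Y → X ⊆? Y ×-dec P? Y) (∣_∣ ∘ ∁) X (⊆-refl , PX)
... | Y , (X⊆Y , PY) , min = Y , X⊆Y , PY , λ Z Y⊂Z PZ →
  <⇒≱ (p⊂q⇒∣p∣<∣q∣ (p⊂q⇒∁p⊃∁q Y⊂Z)) (min Z (⊆-trans X⊆Y (p⊂q⇒p⊆q Y⊂Z) , PZ))

-- Reachability and linkages

module _ {G : Graph} where

  Reach-trans : ∀ {S u v w} → Reach G S u v → Reach G S v w → Reach G S u w
  Reach-trans (here _)     q = q
  Reach-trans (step s a p) q = step s a (Reach-trans p q)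

  Reach-mono : ∀ {S S′ : V G → Set} → (∀ x → S x → S′ x) → ∀ {u v} → Reach G S u v → Reach G S′ u v
  Reach-mono f (here s)     = here (f _ s)
  Reach-mono f (step s a p) = step (f _ s) a (Reach-mono f p)

  Adj-sym : ∀ {u v} → Adj G u v → Adj G v u
  Adj-sym {u} {v} a = trans (Graph.sym G v u) a

  Adj? : ∀ u v → Dec (Adj G u v)
  Adj? u v = adj G u v Bool.≟ true

assign : ∀ {n} {B : Set} → (Fin n → B) → Fin n → B → Fin n → B
assign f v y w with w Fin.≟ v
... | yes _ = y
... | no _  = f w

assign-≡ : ∀ {n} {B : Set} (f : Fin n → B) v y → assign f v y v ≡ y
assign-≡ f v y with v Fin.≟ v
... | yes _  = refl
... | no v≢v = ⊥-elim (v≢v refl)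

assign-≢ : ∀ {n} {B : Set} (f : Fin n → B) {v} y {w} → w ≢ v → assign f v y w ≡ f w
assign-≢ f {v} y {w} w≢v with w Fin.≟ v
... | yes w≡v = ⊥-elim (w≢v w≡v)
... | no _    = refl

module _ (G : Graph) where

  Bd : (T R X : Subset (n G)) → V G → Set
  Bd T R X v = v ∈ X × v ∉ R × (v ∈ T ⊎ ∃ λ w → Adj G v w × w ∉ X)

  Bd? : ∀ T R X → Decidable (Bd T R X)
  Bd? T R X v =
    v ∈? X ×-dec ¬? (v ∈? R) ×-dec (v ∈? T ⊎-dec any? λ w → Adj? {G} v w ×-dec ¬? (w ∈? X))

  -- The boundary of X when R is deleted and a pendant vertex outside X is attached to each vertex of T.
  bd : (T R X : Subset (n G)) → Subset (n G)
  bd T R X = ⟪ Bd? T R X ⟫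

  bd⁺ : ∀ {T R X v} → Bd T R X v → v ∈ bd T R X
  bd⁺ {T} {R} {X} = ∈⟪⟫⁺ (Bd? T R X)

  bd⁻ : ∀ {T R X v} → v ∈ bd T R X → Bd T R X v
  bd⁻ {T} {R} {X} = ∈⟪⟫⁻ (Bd? T R X)

  ∂ : Subset (n G) → Subset (n G)
  ∂ = bd ⊥ ⊥

  ∂⁺ : ∀ {X v w} → v ∈ X → Adj G v w → w ∉ X → v ∈ ∂ X
  ∂⁺ v∈X a w∉X = bd⁺ (v∈X , ∉⊥ , inj₂ (_ , a , w∉X))

  ∂⁻ : ∀ {X v} → v ∈ ∂ X → v ∈ X × ∃ λ w → Adj G v w × w ∉ X
  ∂⁻ v∈ with bd⁻ v∈
  ... | v∈X , _ , inj₁ v∈⊥ = ⊥-elim (∉⊥ v∈⊥)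
  ... | v∈X , _ , inj₂ w   = v∈X , w

  -- By inclusion-exclusion on both sides it suffices that a vertex on either boundary on the left
  -- is on `∂ A` or `∂ B`, and that a vertex on both is on both.
  ∂-submodular : ∀ A B → ∣ ∂ (A ∩ B) ∣ + ∣ ∂ (A ∪ B) ∣ ≤ ∣ ∂ A ∣ + ∣ ∂ B ∣
  ∂-submodular A B = begin
    ∣ ∂ (A ∩ B) ∣ + ∣ ∂ (A ∪ B) ∣
      ≡⟨ ≡-sym (∣∪∣+∣∩∣ (∂ (A ∩ B)) (∂ (A ∪ B))) ⟩
    ∣ ∂ (A ∩ B) ∪ ∂ (A ∪ B) ∣ + ∣ ∂ (A ∩ B) ∩ ∂ (A ∪ B) ∣
      ≤⟨ +-mono-≤ (p⊆q⇒∣p∣≤∣q∣ (∪-lub meet join)) (p⊆q⇒∣p∣≤∣q∣ both) ⟩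
    ∣ ∂ A ∪ ∂ B ∣ + ∣ ∂ A ∩ ∂ B ∣
      ≡⟨ ∣∪∣+∣∩∣ (∂ A) (∂ B) ⟩
    ∣ ∂ A ∣ + ∣ ∂ B ∣ ∎
    where
    open ≤-Reasoning
    meet : ∂ (A ∩ B) ⊆ ∂ A ∪ ∂ B
    meet v∈ with ∂⁻ v∈
    ... | v∈∩ , w , a , w∉ with x∈p∩q⁻ A B v∈∩ | w ∈? A
    ...   | v∈A , v∈B | no w∉A  = p⊆p∪q (∂ B) (∂⁺ v∈A a w∉A)
    ...   | v∈A , v∈B | yes w∈A = q⊆p∪q (∂ A) (∂ B) (∂⁺ v∈B a λ w∈B → w∉ (x∈p∩q⁺ (w∈A , w∈B)))
    join : ∂ (A ∪ B) ⊆ ∂ A ∪ ∂ B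
    join v∈ with ∂⁻ v∈
    ... | v∈∪ , w , a , w∉ with x∈p∪q⁻ A B v∈∪
    ...   | inj₁ v∈A = p⊆p∪q (∂ B) (∂⁺ v∈A a (w∉ ∘ p⊆p∪q B))
    ...   | inj₂ v∈B = q⊆p∪q (∂ A) (∂ B) (∂⁺ v∈B a (w∉ ∘ q⊆p∪q A B))
    both : ∂ (A ∩ B) ∩ ∂ (A ∪ B) ⊆ ∂ A ∩ ∂ B
    both v∈ with x∈p∩q⁻ (∂ (A ∩ B)) (∂ (A ∪ B)) v∈
    ... | v∈₁ , v∈₂ with x∈p∩q⁻ A B (proj₁ (∂⁻ v∈₁)) | ∂⁻ v∈₂
    ...   | v∈A , v∈B | _ , w , a , w∉ =
      x∈p∩q⁺ (∂⁺ v∈A a (w∉ ∘ p⊆p∪q B) , ∂⁺ v∈B a (w∉ ∘ q⊆p∪q A B))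

  bd-∪⁅⁆ : ∀ {T R X} v → bd T R (X ∪ ⁅ v ⁆) ⊆ bd T R X ∪ ⁅ v ⁆
  bd-∪⁅⁆ {T} {R} {X} v {u} u∈ with bd⁻ u∈
  ... | u∈X+v , u∉R , out with x∈p∪q⁻ X _ u∈X+v
  ...   | inj₂ u∈v = q⊆p∪q (bd T R X) _ u∈v
  ...   | inj₁ u∈X = p⊆p∪q _ (bd⁺ (u∈X , u∉R , [ inj₁ , (λ { (w , a , w∉) → inj₂ (w , a , w∉ ∘ p⊆p∪q _) }) ]′ out))

  -- Disjoint paths from the classes of `φ` to the boundary of `X`, one for each label in `F`,
  -- encoded as an enlarged labelling. Disjointness is then automatic, and `linked` keeps each
  -- enlarged class attached to the old one.
  record Linkage {m} (F : Subset m) (T R X : Subset (n G)) (φ : V G → Maybe (Fin m)) : Set where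
    field
      ψ       : V G → Maybe (Fin m)
      end     : Fin m → V G
      extends : ∀ {v h} → φ v ≡ just h → ψ v ≡ just h
      inside  : ∀ {v h} → ψ v ≡ just h → v ∈ X
      linked  : ∀ {v h} → ψ v ≡ just h → ∃ λ u → φ u ≡ just h × Reach G (λ x → ψ x ≡ just h) v u
      ends    : ∀ {h} → h ∈ F → ψ (end h) ≡ just h × Bd T R X (end h)

  Linkage-trans : ∀ {m} {F : Subset m} {T R X Y φ} (ℒ : Linkage F T R X φ) →
                  Linkage F T R Y (Linkage.ψ ℒ) → Linkage F T R Y φ
  Linkage-trans ℒ ℒ′ = record
    { ψ       = ℒ′.ψ
    ; end     = ℒ′.end
    ; extends = ℒ′.extends ∘ ℒ.extends
    ; inside  = ℒ′.inside
    ; linked  = λ e → case ℒ′.linked e of λ { (u , e₁ , p) → case ℒ.linked e₁ of λ { (u′ , e₂ , q) →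
                  u′ , e₂ , Reach-trans p (Reach-mono (λ _ → ℒ′.extends) q) } }
    ; ends    = ℒ′.ends
    }
    where module ℒ = Linkage ℒ
          module ℒ′ = Linkage ℒ′

  Linkage-step : ∀ {m} {F : Subset m} {T R R₁ Y φ x v h} → φ x ≡ just h → (∀ {g} → φ v ≢ just g) →
                 Adj G x v → R ⊆ R₁ → Linkage F T R₁ Y (assign φ v (just h)) → Linkage F T R Y φ
  Linkage-step {φ = φ} {x} {v} {h} φx φv x~v R⊆R₁ ℒ = record
    { ψ = ℒ.ψ ; end = ℒ.end ; extends = extends′ ; inside = ℒ.inside ; linked = linked′
    ; ends = λ h∈F → case ℒ.ends h∈F of λ { (e , y∈ , y∉ , out) → e , y∈ , y∉ ∘ R⊆R₁ , out } }
    where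
    module ℒ = Linkage ℒ
    extends′ : ∀ {w g} → φ w ≡ just g → ℒ.ψ w ≡ just g
    extends′ e = ℒ.extends (trans (assign-≢ φ _ (λ { refl → φv e })) e)
    linked′ : ∀ {w g} → ℒ.ψ w ≡ just g →
              ∃ λ u → φ u ≡ just g × Reach G (λ y → ℒ.ψ y ≡ just g) w u
    linked′ e with ℒ.linked e
    ... | u , φ₁u , p with u Fin.≟ v
    ...   | no _ = u , φ₁u , p
    ...   | yes refl with just-injective φ₁u
    ...     | refl = x , φx , Reach-trans p (step (ℒ.extends (assign-≡ φ v _)) (Adj-sym {G} x~v)
                      (here (extends′ φx)))

  -- If some tight Y lies strictly between X and X′, link X to Y and Y to X′;
  -- otherwise every such Y has slack, so that the end x can be deleted after stepping from x to v.
  menger : ∀ {m} (F : Subset m) (T R X X′ : Subset (n G)) (φ : V G → Maybe (Fin m)) (b : Fin m → V G) →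
           X ⊆ X′ → ∣ bd T R X ∣ ≤ ∣ F ∣ →
           (∀ Y → X ⊆ Y → Y ⊆ X′ → ∣ F ∣ ≤ ∣ bd T R Y ∣) →
           (∀ {v h} → φ v ≡ just h → v ∈ X) →
           (∀ {h} → h ∈ F → φ (b h) ≡ just h × Bd T R X (b h)) →
           Linkage F T R X′ φ
  menger {m} F T R₀ X₀ X₀′ φ₀ b₀ X⊆X′₀ small₀ low₀ in₀ ends₀ =
    -- The fuel bounds the size of `X′` minus that of `X`; it drops for both halves of a split and
    -- when `v` joins `X`.
    go ∣ X₀′ ∣ R₀ X₀ X₀′ φ₀ b₀ (m≤m+n _ _) X⊆X′₀ small₀ low₀ in₀ ends₀
    where
    go : ∀ fuel R X X′ φ (b : Fin m → V G) → ∣ X′ ∣ ≤ fuel + ∣ X ∣ → X ⊆ X′ → ∣ bd T R X ∣ ≤ ∣ F ∣ →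
         (∀ Y → X ⊆ Y → Y ⊆ X′ → ∣ F ∣ ≤ ∣ bd T R Y ∣) →
         (∀ {v h} → φ v ≡ just h → v ∈ X) →
         (∀ {h} → h ∈ F → φ (b h) ≡ just h × Bd T R X (b h)) →
         Linkage F T R X′ φ
    go fuel R X X′ φ b size X⊆X′ small low in-X ends
      with any? (λ h → h ∈? F ×-dec ¬? (Bd? T R X′ (b h)))
    go fuel R X X′ φ b size X⊆X′ small low in-X ends | no ¬h = record
      { ψ = φ ; end = b ; extends = id ; inside = X⊆X′ ∘ in-X
      ; linked = λ e → _ , e , here e
      ; ends = λ {h} h∈F → proj₁ (ends h∈F) ,
                 decidable-stable (Bd? T R X′ (b h)) λ ¬Bd → ¬h (h , h∈F , ¬Bd) }
    go fuel R X X′ φ b size X⊆X′ small low in-X ends | yes (h , h∈F , ¬Bd) with ends h∈F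
    ... | φx , x∈X , x∉R , inj₁ x∈T = ⊥-elim (¬Bd (X⊆X′ x∈X , x∉R , inj₁ x∈T))
    ... | φx , x∈X , x∉R , inj₂ (v , x~v , v∉X) = split fuel size
      where
      x = b h
      v∈X′ : v ∈ X′
      v∈X′ = decidable-stable (v ∈? X′) λ v∉X′ → ¬Bd (X⊆X′ x∈X , x∉R , inj₂ (v , x~v , v∉X′))
      X₁ = X ∪ ⁅ v ⁆
      X₁⊆X′ : X₁ ⊆ X′
      X₁⊆X′ = ∪-lub X⊆X′ (⁅⁆⊆ v∈X′)
      X⊂X₁ : X ⊂ X₁
      X⊂X₁ = ⊂-intro (p⊆p∪q _) (∈-∪⁅⁆ X v) v∉X
      split : ∀ fuel → ∣ X′ ∣ ≤ fuel + ∣ X ∣ → Linkage F T R X′ φ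
      split zero size = ⊥-elim (v∉X (⊆-tight X⊆X′ size v∈X′))
      split (suc fuel) size
        with anySubset? (λ Y → X ⊂? Y ×-dec Y ⊂? X′ ×-dec ∣ bd T R Y ∣ ≤? ∣ F ∣)
      ... | yes (Y , X⊂Y , Y⊂X′ , tight) = Linkage-trans ℒ ℒ′
        where
        ℒ = go fuel R X Y φ b
              (s≤s⁻¹ (≤-trans (p⊂q⇒∣p∣<∣q∣ Y⊂X′) size))
              (p⊂q⇒p⊆q X⊂Y) small (λ Z X⊆Z Z⊆Y → low Z X⊆Z (⊆-trans Z⊆Y (p⊂q⇒p⊆q Y⊂X′))) in-X ends
        module ℒ = Linkage ℒ
        ℒ′ = go fuel R Y X′ ℒ.ψ ℒ.end
               (≤-trans size (≤-trans (≤-reflexive (≡-sym (+-suc fuel _)))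
                 (+-monoʳ-≤ fuel (p⊂q⇒∣p∣<∣q∣ X⊂Y))))
               (p⊂q⇒p⊆q Y⊂X′) tight (λ Z Y⊆Z → low Z (⊆-trans (p⊂q⇒p⊆q X⊂Y) Y⊆Z)) ℒ.inside ℒ.ends
      ... | no ¬tight = Linkage-step φx (λ e → v∉X (in-X e)) x~v (p⊆p∪q _) ℒ
        where
        R₁ = R ∪ ⁅ x ⁆
        φ₁ = assign φ v (just h)
        b₁ = assign b h v
        -- Deleting `x` costs at most one boundary vertex, which the strict inequality absorbs when
        -- `Y` is not `X′`. The boundary of `X′` does not contain `x` by `¬Bd`.
        slack : ∀ Y → X₁ ⊆ Y → Y ⊆ X′ → ∣ F ∣ ≤ ∣ bd T R₁ Y ∣
        slack Y X₁⊆Y Y⊆X′ with Y ⊂? X′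
        ... | yes Y⊂X′ = s≤s⁻¹ (≤-trans
                (≰⇒> λ tight → ¬tight (Y , ⊂-⊆-trans X⊂X₁ X₁⊆Y , Y⊂X′ , tight))
                (≤-trans (p⊆q⇒∣p∣≤∣q∣ un-delete) (∣∪⁅⁆∣≤ (bd T R₁ Y) x)))
          where
          un-delete : bd T R Y ⊆ bd T R₁ Y ∪ ⁅ x ⁆
          un-delete {u} u∈ with u Fin.≟ x | bd⁻ u∈
          ... | yes refl | _ = ∈-∪⁅⁆ (bd T R₁ Y) x
          ... | no u≢x | u∈Y , u∉R , out = p⊆p∪q _
                  (bd⁺ (u∈Y , [ u∉R , u≢x ∘ x∈⁅y⁆⇒x≡y x ]′ ∘ x∈p∪q⁻ R _ , out))
        ... | no Y⊄X′ with ⊆-antisym Y⊆X′ (λ {u} u∈X′ → decidable-stable (u ∈? Y)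
                            λ u∉Y → Y⊄X′ (⊂-intro Y⊆X′ u∈X′ u∉Y))
        ...   | refl = ≤-trans (low Y X⊆X′ Y⊆X′) (p⊆q⇒∣p∣≤∣q∣ un-delete)
          where
          un-delete : bd T R Y ⊆ bd T R₁ Y
          un-delete {u} u∈ with bd⁻ u∈
          ... | u∈Y , u∉R , out = bd⁺ (u∈Y ,
                  [ u∉R , (λ u∈x → ¬Bd (subst (Bd T R Y) (x∈⁅y⁆⇒x≡y x u∈x) (bd⁻ u∈))) ]′ ∘ x∈p∪q⁻ R _ , out)
        -- On the boundary `x` is replaced by `v`. The new boundary lies in `old`, which has at most
        -- `∣ F ∣` vertices, so `slack` at `X₁` forces equality and the other ends remain boundary
        -- vertices.
        old = (bd T R X - x) ∪ ⁅ v ⁆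
        bd₁⊆old : bd T R₁ X₁ ⊆ old
        bd₁⊆old {u} u∈ with bd⁻ u∈
        ... | u∈X₁ , u∉R₁ , out with x∈p∪q⁻ (bd T R X) _ (bd-∪⁅⁆ v (bd⁺ (u∈X₁ , u∉R₁ ∘ p⊆p∪q _ , out)))
        ...   | inj₁ u∈bd = p⊆p∪q _ (x∈p∧x≢y⇒x∈p-y u∈bd λ { refl → u∉R₁ (∈-∪⁅⁆ R x) })
        ...   | inj₂ u∈v  = q⊆p∪q (bd T R X - x) _ u∈v
        ∣old∣≤ : ∣ old ∣ ≤ ∣ F ∣
        ∣old∣≤ = ≤-trans (∣∪⁅⁆∣≤ (bd T R X - x) v)
                  (≤-trans (x∈p⇒∣p-x∣<∣p∣ (bd⁺ (proj₂ (ends h∈F)))) small)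
        old⊆bd₁ : old ⊆ bd T R₁ X₁
        old⊆bd₁ = ⊆-tight bd₁⊆old (≤-trans ∣old∣≤ (slack X₁ ⊆-refl X₁⊆X′))
        ends₁ : ∀ {g} → g ∈ F → φ₁ (b₁ g) ≡ just g × Bd T R₁ X₁ (b₁ g)
        ends₁ {g} g∈F with g Fin.≟ h
        ... | yes refl = assign-≡ φ v _ , bd⁻ (old⊆bd₁ (∈-∪⁅⁆ (bd T R X - x) v))
        ... | no g≢h with ends g∈F
        ...   | φbg , Bdbg = trans (assign-≢ φ _ λ { refl → v∉X (in-X φbg) }) φbg ,
                bd⁻ (old⊆bd₁ (p⊆p∪q _ (x∈p∧x≢y⇒x∈p-y (bd⁺ Bdbg)
                  λ bg≡x → g≢h (just-injective (trans (≡-sym φbg) (trans (cong φ bg≡x) φx))))))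
        in-X₁ : ∀ {w g} → φ₁ w ≡ just g → w ∈ X₁
        in-X₁ {w} e with w Fin.≟ v
        ... | yes refl = ∈-∪⁅⁆ X v
        ... | no _     = p⊆p∪q _ (in-X e)
        ℒ = go fuel R₁ X₁ X′ φ₁ b₁
              (≤-trans size (≤-trans (≤-reflexive (≡-sym (+-suc fuel _)))
                (+-monoʳ-≤ fuel (p⊂q⇒∣p∣<∣q∣ X⊂X₁))))
              X₁⊆X′ (≤-trans (p⊆q⇒∣p∣≤∣q∣ bd₁⊆old) ∣old∣≤) slack in-X₁ ends₁

-- Excluding a rooted forest

Reach-head : ∀ {G : Graph} {S u v} → Reach G S u v → S u
Reach-head (here s)     = s
Reach-head (step s _ _) = s

Reach-sym : ∀ {G : Graph} {S u v} → Reach G S u v → Reach G S v u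
Reach-sym (here s)         = here s
Reach-sym {G} (step s a p) = Reach-trans (Reach-sym p) (step (Reach-head p) (Adj-sym {G} a) (here s))

-- That `F` induces a forest, given as an order of leaf removals. Read backwards, it adds each
-- vertex with at most one neighbour already present, which is how a model is grown.
data Peelable (H : Graph) : Subset (n H) → Set where
  empty : ∀ {F} → ¬ Nonempty F → Peelable H F
  leaf  : ∀ {F} h → h ∈ F → Peelable H (F - h) →
          (∀ {h₁ h₂} → h₁ ∈ F → h₂ ∈ F → Adj H h h₁ → Adj H h h₂ → h₁ ≡ h₂) → Peelable H F

record PartialModel (H G : Graph) (F : Subset (n H)) (φ : V G → Maybe (V H)) : Set where
  field
    support   : ∀ {v h} → φ v ≡ just h → h ∈ F
    connected : ∀ {v v′ h} → φ v ≡ just h → φ v′ ≡ just h → Reach G (λ x → φ x ≡ just h) v v′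
    edges     : ∀ {h h′} → h ∈ F → h′ ∈ F → Adj H h h′ →
                ∃ λ g → ∃ λ g′ → φ g ≡ just h × φ g′ ≡ just h′ × Adj G g g′

module _ {H G : Graph} where

  PartialModel-extend : ∀ {F T R X φ} → PartialModel H G F φ → (ℒ : Linkage G F T R X φ) →
                        PartialModel H G F (Linkage.ψ ℒ)
  PartialModel-extend ℳ ℒ = record
    { support = λ e → ℳ.support (proj₁ (proj₂ (ℒ.linked e)))
    ; connected = λ e e′ → case ℒ.linked e of λ { (u , φu , p) → case ℒ.linked e′ of λ { (u′ , φu′ , p′) →
        Reach-trans p (Reach-trans (Reach-mono (λ _ → ℒ.extends) (ℳ.connected φu φu′)) (Reach-sym p′)) } }
    ; edges = λ h∈ h′∈ a → case ℳ.edges h∈ h′∈ a of λ { (g , g′ , e , e′ , a′) →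
        g , g′ , ℒ.extends e , ℒ.extends e′ , a′ }
    }
    where module ℳ = PartialModel ℳ
          module ℒ = Linkage ℒ

  PartialModel-assign : ∀ {F h φ v} → h ∈ F → PartialModel H G (F - h) φ → (∀ {g} → φ v ≢ just g) →
                        (∀ {h′} → h′ ∈ F - h → Adj H h h′ → ∃ λ g → φ g ≡ just h′ × Adj G g v) →
                        PartialModel H G F (assign φ v (just h))
  PartialModel-assign {F} {h} {φ} {v} h∈F ℳ φv attach = record
    { support = λ {w} → support′ {w} ; connected = connected′ ; edges = edges′ }
    where
    module ℳ = PartialModel ℳ
    φ₁ = assign φ v (just h)
    old : ∀ {w g} → φ w ≡ just g → φ₁ w ≡ just g
    old e = trans (assign-≢ φ _ λ { refl → φv e }) e
    new : φ₁ v ≡ just h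
    new = assign-≡ φ v _
    φ-h : ∀ {w} → φ w ≢ just h
    φ-h e = proj₂ (∈-⁻ F h (ℳ.support e)) refl
    support′ : ∀ {w g} → φ₁ w ≡ just g → g ∈ F
    support′ {w} e with w Fin.≟ v
    ... | no _ = proj₁ (∈-⁻ F h (ℳ.support e))
    ... | yes refl with just-injective e
    ...   | refl = h∈F
    connected′ : ∀ {w w′ g} → φ₁ w ≡ just g → φ₁ w′ ≡ just g → Reach G (λ x → φ₁ x ≡ just g) w w′
    connected′ {w} {w′} e e′ with w Fin.≟ v | w′ Fin.≟ v
    ... | no _     | no _     = Reach-mono (λ _ → old) (ℳ.connected e e′)
    ... | yes refl | no _     with just-injective e
    ...   | refl = ⊥-elim (φ-h e′)
    connected′ {w} {w′} e e′ | no _     | yes refl with just-injective e′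
    ...   | refl = ⊥-elim (φ-h e)
    connected′ {w} {w′} e e′ | yes refl | yes refl = here (trans new e)
    edges′ : ∀ {g g′} → g ∈ F → g′ ∈ F → Adj H g g′ →
             ∃ λ x → ∃ λ x′ → φ₁ x ≡ just g × φ₁ x′ ≡ just g′ × Adj G x x′
    edges′ {g} {g′} g∈ g′∈ a with g Fin.≟ h | g′ Fin.≟ h
    ... | yes refl | yes refl = contradiction (trans (≡-sym a) (loopless H g)) λ ()
    ... | yes refl | no g′≢h with attach (x∈p∧x≢y⇒x∈p-y g′∈ g′≢h) a
    ...   | x , e , a′ = v , x , new , old e , Adj-sym {G} a′
    edges′ {g} {g′} g∈ g′∈ a | no g≢h | yes refl
      with attach (x∈p∧x≢y⇒x∈p-y g∈ g≢h) (Adj-sym {H} a)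
    ...   | x , e , a′ = x , v , old e , new , a′
    edges′ {g} {g′} g∈ g′∈ a | no g≢h | no g′≢h
      with ℳ.edges (x∈p∧x≢y⇒x∈p-y g∈ g≢h) (x∈p∧x≢y⇒x∈p-y g′∈ g′≢h) a
    ...   | x , x′ , e , e′ , a′ = x , x′ , old e , old e′ , a′

-- Growing a forest model along good sets

module _ (G : Graph) (S : Subset (n G)) (p : ℕ) where

  -- Prefixes of a path decomposition in which the parts between consecutive sets may be large
  -- as long as they meet S in few vertices.
  data Good : Subset (n G) → Set where
    start  : Good ⊥
    extend : ∀ {X Y} → Good X → X ⊂ Y → ∣ ∂ G Y ∣ ≤ p → ∣ S ∩ (Y ─ X) ∣ ≤ p → Good Y

  -- Search for a last step over all proper subsets, recursively. Decidability is what makes maximal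
  -- good sets available.
  Good? : Decidable Good
  Good? Y₀ = go ∣ Y₀ ∣ Y₀ ≤-refl
    where
    go : ∀ fuel Y → ∣ Y ∣ ≤ fuel → Dec (Good Y)
    go fuel Y size with nonempty? Y
    ... | no ¬ne = yes (subst Good (≡-sym (Empty-unique ¬ne)) start)
    ... | yes (v , v∈Y) with anySubset? previous?
      where
      shrink : ∀ fuel → ∣ Y ∣ ≤ fuel → ∀ X → X ⊂ Y → Dec (Good X)
      shrink zero       size X X⊂Y = ⊥-elim (n≮0 (≤-trans (p⊂q⇒∣p∣<∣q∣ X⊂Y) size))
      shrink (suc fuel) size X X⊂Y = go fuel X (s≤s⁻¹ (≤-trans (p⊂q⇒∣p∣<∣q∣ X⊂Y) size))
      previous? : Decidable (λ X → X ⊂ Y × Good X × ∣ ∂ G Y ∣ ≤ p × ∣ S ∩ (Y ─ X) ∣ ≤ p)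
      previous? X with X ⊂? Y
      ... | no X⊄Y = no (X⊄Y ∘ proj₁)
      ... | yes X⊂Y with shrink fuel size X X⊂Y ×-dec ∣ ∂ G Y ∣ ≤? p ×-dec ∣ S ∩ (Y ─ X) ∣ ≤? p
      ...   | yes r = yes (X⊂Y , r)
      ...   | no ¬r = no (¬r ∘ proj₂)
    ...   | yes (X , X⊂Y , good , small , few) = yes (extend good X⊂Y small few)
    ...   | no ¬X = no λ { start → ∉⊥ v∈Y
                         ; (extend good X⊂Y small few) → ¬X (_ , X⊂Y , good , small , few) }

  Good-extend : ∀ {X Y} → Good X → X ⊆ Y → ∣ ∂ G Y ∣ ≤ p → ∣ S ∩ (Y ─ X) ∣ ≤ p → Good Y
  Good-extend {X} {Y} good X⊆Y small few with X ⊂? Y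
  ... | yes X⊂Y = extend good X⊂Y small few
  ... | no X⊄Y  = subst Good (⊆-antisym X⊆Y λ {v} v∈Y → decidable-stable (v ∈? X)
                    λ v∉X → X⊄Y (⊂-intro X⊆Y v∈Y v∉X)) good

  -- Diestel's lemma, with submodularity in place of contracting a linkage.
  Good-∩ : ∀ {X′ Y} → Y ⊆ X′ → (∀ Z → Y ⊆ Z → Z ⊆ X′ → ∣ ∂ G Y ∣ ≤ ∣ ∂ G Z ∣) →
           ∀ {X} → Good X → X ⊆ X′ → Good (X ∩ Y)
  Good-∩ {X′} {Y} Y⊆X′ min start _ =
    subst Good (≡-sym (Empty-unique λ { (_ , v∈) → ∉⊥ (p∩q⊆p ⊥ Y v∈) })) start
  Good-∩ {X′} {Y} Y⊆X′ min (extend {X} {Z} good X⊂Z small few) Z⊆X′ =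
    Good-extend (Good-∩ Y⊆X′ min good (⊆-trans (p⊂q⇒p⊆q X⊂Z) Z⊆X′))
      (λ v∈ → case x∈p∩q⁻ X Y v∈ of λ { (v∈X , v∈Y) → x∈p∩q⁺ (p⊂q⇒p⊆q X⊂Z v∈X , v∈Y) })
      -- `Z ∪ Y` lies between `Y` and `X′`, so its boundary is no smaller than that of `Y`;
      -- submodularity then bounds the boundary of `Z ∩ Y` by that of `Z`.
      (≤-trans (+-cancelʳ-≤ (∣ ∂ G Y ∣) _ _ (≤-trans
        (+-monoʳ-≤ ∣ ∂ G (Z ∩ Y) ∣ (min (Z ∪ Y) (q⊆p∪q Z Y) (∪-lub Z⊆X′ Y⊆X′)))
        (∂-submodular G Z Y))) small)
      (≤-trans (p⊆q⇒∣p∣≤∣q∣ fewer) few)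
    where
    fewer : S ∩ ((Z ∩ Y) ─ (X ∩ Y)) ⊆ S ∩ (Z ─ X)
    fewer v∈ with x∈p∩q⁻ S _ v∈
    ... | v∈S , v∈─ with ∈─⁻ (Z ∩ Y) (X ∩ Y) v∈─
    ...   | v∈∩ , v∉∩ with x∈p∩q⁻ Z Y v∈∩
    ...     | v∈Z , v∈Y = x∈p∩q⁺ (v∈S , x∈p∧x∉q⇒x∈p─q v∈Z λ v∈X → v∉∩ (x∈p∩q⁺ (v∈X , v∈Y)))

  -- The invariant of Diestel's induction. Ends with different labels are different, so `small`
  -- makes them the whole boundary: each branch set meets `∂ G X` in exactly its end.
  record Stage (H : Graph) (F : Subset (n H)) : Set where
    field
      X       : Subset (n G)
      good    : Good X
      maximum : ∀ {Y} → X ⊂ Y → ∣ ∂ G Y ∣ ≤ ∣ F ∣ → ¬ Good Y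
      small   : ∣ ∂ G X ∣ ≤ ∣ F ∣
      large   : ∣ F ∣ ≤ ∣ ∂ G X ∣
      φ       : V G → Maybe (V H)
      b       : V H → V G
      model   : PartialModel H G F φ
      inside  : ∀ {v h} → φ v ≡ just h → v ∈ X
      ends    : ∀ {h} → h ∈ F → φ (b h) ≡ just h × Bd G ⊥ ⊥ X (b h)

  maximalGood : ∀ {X} k → Good X → ∣ ∂ G X ∣ ≤ k →
                ∃ λ Y → X ⊆ Y × (Good Y × ∣ ∂ G Y ∣ ≤ k) × (∀ {Z} → Y ⊂ Z → ∣ ∂ G Z ∣ ≤ k → ¬ Good Z)
  maximalGood {X} k good small with maximal (λ Y → Good? Y ×-dec ∣ ∂ G Y ∣ ≤? k) X (good , small)
  ... | Y , X⊆Y , PY , max = Y , X⊆Y , PY , λ Y⊂Z small′ good′ → max _ Y⊂Z (good′ , small′)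

  initial : ∀ {H F} → V G → V H → ¬ Nonempty F → Stage H F
  initial {H} {F} v₀ h₀ ¬ne with maximalGood ∣ F ∣ start
    (∣∅∣≤ λ { (_ , v∈) → ∉⊥ (proj₁ (∂⁻ G v∈)) })
  ... | X , _ , (good , small) , max = record
    { X = X ; good = good ; maximum = max ; small = small
    ; large = ∣∅∣≤ ¬ne
    ; φ = λ _ → nothing ; b = λ _ → v₀
    ; model = record { support = λ () ; connected = λ () ; edges = λ h∈F → ⊥-elim (¬ne (_ , h∈F)) }
    ; inside = λ () ; ends = λ h∈F → ⊥-elim (¬ne (_ , h∈F)) }

  advance : ∀ {H F h v} → ∣ F ∣ ≤ p → h ∈ F → (st : Stage H (F - h)) → v ∉ Stage.X st →
            (∀ {h′} → h′ ∈ F - h → Adj H h h′ → ∃ λ g → Stage.φ st g ≡ just h′ × Adj G g v) → Stage H F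
  advance {H} {F} {h} {v} F≤p h∈F st v∉X attach = record
    { X = X′ ; good = good′ ; maximum = maximum′ ; small = small′ ; large = low X′ X₁⊆X′ ⊆-refl
    ; φ = ℒ.ψ ; b = ℒ.end ; model = PartialModel-extend model₁ ℒ ; inside = ℒ.inside ; ends = ℒ.ends }
    where
    open Stage st
    X₁ = X ∪ ⁅ v ⁆
    φ₁ = assign φ v (just h)
    b₁ = assign b h v
    model₁ : PartialModel H G F φ₁
    model₁ = PartialModel-assign h∈F model (v∉X ∘ inside) attach
    F-h<F : suc ∣ F - h ∣ ≤ ∣ F ∣
    F-h<F = x∈p⇒∣p-x∣<∣p∣ h∈F
    F≤F-h : ∣ F ∣ ≤ suc ∣ F - h ∣
    F≤F-h = ≤-trans (p⊆q⇒∣p∣≤∣q∣ cover) (∣∪⁅⁆∣≤ (F - h) h)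
      where
      cover : F ⊆ (F - h) ∪ ⁅ h ⁆
      cover {g} g∈F with g Fin.≟ h
      ... | yes refl = ∈-∪⁅⁆ (F - h) h
      ... | no g≢h   = p⊆p∪q _ (x∈p∧x≢y⇒x∈p-y g∈F g≢h)
    ∣∂X+v∣≤ : ∣ ∂ G X ∪ ⁅ v ⁆ ∣ ≤ ∣ F ∣
    ∣∂X+v∣≤ = ≤-trans (∣∪⁅⁆∣≤ (∂ G X) v) (≤-trans (s≤s small) F-h<F)
    small₁ : ∣ ∂ G X₁ ∣ ≤ ∣ F ∣
    small₁ = ≤-trans (p⊆q⇒∣p∣≤∣q∣ (bd-∪⁅⁆ G v)) ∣∂X+v∣≤
    good₁ : Good X₁
    good₁ = Good-extend good (p⊆p∪q _) (≤-trans small₁ F≤p)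
      (≤-trans (p⊆q⇒∣p∣≤∣q∣ only-v) (≤-trans (≤-reflexive (∣⁅x⁆∣≡1 v))
        (≤-trans (s≤s z≤n) (≤-trans F-h<F F≤p))))
      where
      only-v : S ∩ (X₁ ─ X) ⊆ ⁅ v ⁆
      only-v w∈ with ∈─⁻ X₁ X (p∩q⊆q S _ w∈)
      ... | w∈X₁ , w∉X with x∈p∪q⁻ X _ w∈X₁
      ...   | inj₁ w∈X = ⊥-elim (w∉X w∈X)
      ...   | inj₂ w∈v = w∈v
    top = maximalGood ∣ F ∣ good₁ small₁
    X′ = proj₁ top
    X₁⊆X′ : X₁ ⊆ X′
    X₁⊆X′ = proj₁ (proj₂ top)
    good′ = proj₁ (proj₁ (proj₂ (proj₂ top)))
    small′ = proj₂ (proj₁ (proj₂ (proj₂ top)))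
    maximum′ = proj₂ (proj₂ (proj₂ top))
    low : ∀ Y → X₁ ⊆ Y → Y ⊆ X′ → ∣ F ∣ ≤ ∣ ∂ G Y ∣
    -- Otherwise a set `Z` of least boundary between `X₁` and `X′` has boundary at most `∣ F - h ∣`.
    -- It equals `X′ ∩ Z` and is good by `Good-∩`, against the maximality of `X` for `F - h`.
    low Y X₁⊆Y Y⊆X′ = ≮⇒≥ λ ∂Y<F →
      case minimiser (λ Z → X₁ ⊆? Z ×-dec Z ⊆? X′) (∣_∣ ∘ ∂ G) Y (X₁⊆Y , Y⊆X′) of
      λ { (Z , (X₁⊆Z , Z⊆X′) , min) →
        maximum (⊂-⊆-trans (⊂-intro (p⊆p∪q _) (∈-∪⁅⁆ X v) v∉X) X₁⊆Z)
          (s≤s⁻¹ (≤-trans (s≤s (min Y (X₁⊆Y , Y⊆X′))) (≤-trans ∂Y<F F≤F-h)))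
          (subst Good (⊆-antisym (p∩q⊆q X′ Z) λ w∈Z → x∈p∩q⁺ (Z⊆X′ w∈Z , w∈Z))
            (Good-∩ Z⊆X′ (λ W Z⊆W W⊆X′ → min W (⊆-trans X₁⊆Z Z⊆W , W⊆X′)) good′ ⊆-refl)) }
    -- There is no room for loss: `low` at `X₁` demands as many boundary vertices as `∂ G X` and `v`
    -- provide, so all old ends survive and `v` is an end too.
    saturated : ∂ G X ∪ ⁅ v ⁆ ⊆ ∂ G X₁
    saturated = ⊆-tight (bd-∪⁅⁆ G v) (≤-trans ∣∂X+v∣≤ (low X₁ ⊆-refl X₁⊆X′))
    inside₁ : ∀ {w g} → φ₁ w ≡ just g → w ∈ X₁
    inside₁ {w} e with w Fin.≟ v
    ... | yes refl = ∈-∪⁅⁆ X v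
    ... | no _     = p⊆p∪q _ (inside e)
    ends₁ : ∀ {g} → g ∈ F → φ₁ (b₁ g) ≡ just g × Bd G ⊥ ⊥ X₁ (b₁ g)
    ends₁ {g} g∈F with g Fin.≟ h
    ... | yes refl = assign-≡ φ v _ , bd⁻ G (saturated (∈-∪⁅⁆ (∂ G X) v))
    ... | no g≢h with ends (x∈p∧x≢y⇒x∈p-y g∈F g≢h)
    ...   | e , d = trans (assign-≢ φ _ λ { refl → v∉X (inside e) }) e ,
                    bd⁻ G (saturated (p⊆p∪q _ (bd⁺ G d)))
    ℒ = menger G F ⊥ ⊥ X₁ X′ φ₁ b₁ X₁⊆X′ small₁ low inside₁ ends₁
    module ℒ = Linkage ℒ

  -- The neighbour of `h` already modelled, if any, is unique. Its end lies on the boundary of `X`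
  -- and so has a neighbour outside `X`, where `h` can be placed; without such a neighbour any
  -- vertex outside `X` serves.
  stages : ∀ {H F} → V G → V H → Peelable H F → ∣ F ∣ ≤ p → Good ⊤ ⊎ Stage H F
  stages v₀ h₀ (empty ¬ne) F≤p = inj₂ (initial v₀ h₀ ¬ne)
  stages {H} {F} v₀ h₀ (leaf h h∈F peel unique) F≤p
    with stages v₀ h₀ peel (≤-trans (p⊆q⇒∣p∣≤∣q∣ (proj₁ ∘ ∈-⁻ F h)) F≤p)
  ... | inj₁ good = inj₁ good
  ... | inj₂ st with any? (λ v → ¬? (v ∈? Stage.X st))
                   | any? (λ g → g ∈? (F - h) ×-dec Adj? {H} h g)
  ...   | no ¬v | _ = inj₁ (subst Good (⊆-antisym ⊆⊤ λ {v} _ →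
                        decidable-stable (v ∈? Stage.X st) λ v∉X → ¬v (v , v∉X)) (Stage.good st))
  ...   | yes (v , v∉X) | no ¬g = inj₂ (advance F≤p h∈F st v∉X λ g∈ a → ⊥-elim (¬g (_ , g∈ , a)))
  ...   | yes _ | yes (g , g∈ , a) with Stage.ends st g∈
  ...     | e , g∈X , _ , inj₁ g∈⊥ = ⊥-elim (∉⊥ g∈⊥)
  ...     | e , g∈X , _ , inj₂ (v , g~v , v∉X) = inj₂ (advance F≤p h∈F st v∉X λ g′∈ a′ →
              case unique (proj₁ (∈-⁻ F h g′∈)) (proj₁ (∈-⁻ F h g∈)) a′ a of λ { refl → _ , e , g~v })

  record RootedModel (H : Graph) (F : Subset (n H)) : Set where
    field
      φ     : V G → Maybe (V H)
      model : PartialModel H G F φ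
      root  : ∀ {h} → h ∈ F → ∃ λ v → φ v ≡ just h × v ∈ S

  rooted : ∀ {H F} → V G → V H → Peelable H F → ∣ F ∣ ≤ p → Good ⊤ ⊎ RootedModel H F
  rooted {H} {F} v₀ h₀ peel F≤p with stages v₀ h₀ peel F≤p
  ... | inj₁ good = inj₁ good
  ... | inj₂ st = inj₂ (record { φ = ℒ.ψ ; model = PartialModel-extend model ℒ ; root = root })
    where
    open Stage st
    -- Roots are sought only outside `X`: the boundary of `X` relative to `T` is still `∂ G X`, as
    -- small as the linkage requires, while that of `⊤` is `T` itself.
    T = S ─ X
    low : ∀ Y → X ⊆ Y → Y ⊆ ⊤ → ∣ F ∣ ≤ ∣ bd G T ⊥ Y ∣
    low Y X⊆Y _ = ≮⇒≥ absurd
      where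
      ∂⊆ : ∂ G Y ⊆ bd G T ⊥ Y
      ∂⊆ v∈ with ∂⁻ G v∈
      ... | v∈Y , w = bd⁺ G (v∈Y , ∉⊥ , inj₂ w)
      new⊆ : S ∩ (Y ─ X) ⊆ bd G T ⊥ Y
      new⊆ v∈ with x∈p∩q⁻ S _ v∈
      ... | v∈S , v∈─ with ∈─⁻ Y X v∈─
      ...   | v∈Y , v∉X = bd⁺ G (v∈Y , ∉⊥ , inj₁ (x∈p∧x∉q⇒x∈p─q v∈S v∉X))
      -- `bd G T ⊥ Y` contains both `∂ G Y` and the new vertices of `S`, so if it were small, `Y`
      -- would be one good step beyond `X`. Here the second bound in `extend` comes from.
      absurd : ¬ ∣ bd G T ⊥ Y ∣ < ∣ F ∣
      absurd lt with X ⊂? Y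
      ... | yes X⊂Y = maximum X⊂Y (≤-trans (p⊆q⇒∣p∣≤∣q∣ ∂⊆) (<⇒≤ lt))
              (extend good X⊂Y (≤-trans (p⊆q⇒∣p∣≤∣q∣ ∂⊆) (≤-trans (<⇒≤ lt) F≤p))
                (≤-trans (p⊆q⇒∣p∣≤∣q∣ new⊆) (≤-trans (<⇒≤ lt) F≤p)))
      ... | no X⊄Y with ⊆-antisym X⊆Y (λ {v} v∈Y → decidable-stable (v ∈? X)
                          λ v∉X → X⊄Y (⊂-intro X⊆Y v∈Y v∉X))
      ...   | refl = <⇒≱ lt (≤-trans large (p⊆q⇒∣p∣≤∣q∣ ∂⊆))
    bdT⊆∂ : bd G T ⊥ X ⊆ ∂ G X
    bdT⊆∂ v∈ with bd⁻ G v∈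
    ... | v∈X , _ , inj₁ v∈T = ⊥-elim (proj₂ (∈─⁻ S X v∈T) v∈X)
    ... | v∈X , v∉⊥ , inj₂ w = bd⁺ G (v∈X , v∉⊥ , inj₂ w)
    ends′ : ∀ {h} → h ∈ F → φ (b h) ≡ just h × Bd G T ⊥ X (b h)
    ends′ h∈F with ends h∈F
    ... | e , v∈X , v∉⊥ , inj₁ v∈⊥ = ⊥-elim (∉⊥ v∈⊥)
    ... | e , v∈X , v∉⊥ , inj₂ w   = e , v∈X , v∉⊥ , inj₂ w
    ℒ = menger G F T ⊥ X ⊤ φ b ⊆⊤ (≤-trans (p⊆q⇒∣p∣≤∣q∣ bdT⊆∂) small) low inside ends′
    module ℒ = Linkage ℒ
    root : ∀ {h} → h ∈ F → ∃ λ v → ℒ.ψ v ≡ just h × v ∈ S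
    root h∈F with ℒ.ends h∈F
    ... | e , _ , _ , inj₁ v∈T = _ , e , proj₁ (∈─⁻ S X v∈T)
    ... | e , _ , _ , inj₂ (w , _ , w∉⊤) = ⊥-elim (w∉⊤ ∈⊤)

-- Spines

module _ (G : Graph) where

  record Component (W : Subset (n G)) (a : V G) : Set where
    field
      Z      : Subset (n G)
      a∈Z    : a ∈ Z
      joined : ∀ {z} → z ∈ Z → Reach G (_∈ W) z a
      closed : ∀ {z w} → z ∈ Z → Adj G z w → w ∈ W → w ∈ Z

  component : ∀ W a → a ∈ W → Component W a
  component W a a∈W = grow (n G) ⁅ a ⁆ (m≤m+n _ _) (x∈⁅x⁆ a)
                        λ z∈ → subst (λ z → Reach G (_∈ W) z a) (≡-sym (x∈⁅y⁆⇒x≡y a z∈)) (here a∈W)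
    where
    grow : ∀ fuel Z → n G ≤ fuel + ∣ Z ∣ → a ∈ Z → (∀ {z} → z ∈ Z → Reach G (_∈ W) z a) → Component W a
    grow fuel Z size a∈Z joined
      with any? (λ w → w ∈? W ×-dec ¬? (w ∈? Z) ×-dec any? λ z → z ∈? Z ×-dec Adj? {G} w z)
    grow fuel Z size a∈Z joined | no ¬w = record
      { Z = Z ; a∈Z = a∈Z ; joined = joined
      ; closed = λ {z} {w} z∈Z z~w w∈W → decidable-stable (w ∈? Z)
          λ w∉Z → ¬w (w , w∈W , w∉Z , z , z∈Z , Adj-sym {G} z~w) }
    grow zero Z size a∈Z joined | yes (w , w∈W , w∉Z , _) =
      ⊥-elim (w∉Z (subst (w ∈_) (≡-sym (∣p∣≡n⇒p≡⊤ (≤-antisym (∣p∣≤n Z) size))) ∈⊤))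
    grow (suc fuel) Z size a∈Z joined | yes (w , w∈W , w∉Z , z , z∈Z , w~z) =
      grow fuel (Z ∪ ⁅ w ⁆)
        (≤-trans size (≤-trans (≤-reflexive (≡-sym (+-suc fuel _)))
          (+-monoʳ-≤ fuel (p⊂q⇒∣p∣<∣q∣ (⊂-intro (p⊆p∪q _) (∈-∪⁅⁆ Z w) w∉Z)))))
        (p⊆p∪q _ a∈Z)
        λ {y} y∈ → [ joined , (λ y∈w → subst (λ y → Reach G (_∈ W) y a) (≡-sym (x∈⁅y⁆⇒x≡y w y∈w))
                                 (step w∈W w~z (joined z∈Z))) ]′ (x∈p∪q⁻ Z _ y∈)

  Reach-last : ∀ {S u v} → Reach G S u v → S v
  Reach-last (here s)     = s
  Reach-last (step _ _ p) = Reach-last p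

  Reach? : ∀ W u a → Dec (Reach G (_∈ W) u a)
  Reach? W u a with a ∈? W
  ... | no a∉W = no (a∉W ∘ Reach-last)
  ... | yes a∈W with component W a a∈W
  ...   | record { Z = Z ; a∈Z = a∈Z ; joined = joined ; closed = closed } with u ∈? Z
  ...     | yes u∈Z = yes (joined u∈Z)
  ...     | no u∉Z = no (u∉Z ∘ in-Z)
    where
    in-Z : ∀ {u} → Reach G (_∈ W) u a → u ∈ Z
    in-Z (here _)     = a∈Z
    in-Z (step u∈W u~w p) = closed (in-Z p) (Adj-sym {G} u~w) u∈W

  exit : ∀ {U : V G → Set} M {u v} → Reach G U u v → u ∈ M → v ∉ M →
         ∃ λ x → ∃ λ y → x ∈ M × y ∉ M × Adj G x y
  exit M (here _) u∈M v∉M = ⊥-elim (v∉M u∈M)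
  exit M (step {u} {w} _ u~w p) u∈M v∉M with w ∈? M
  ... | yes w∈M = exit M p w∈M v∉M
  ... | no w∉M  = u , w , u∈M , w∉M , u~w

  Good-small : ∀ {S p X} → Good G S p X → ∣ ∂ G X ∣ ≤ p
  Good-small start                 = ∣∅∣≤ λ { (_ , v∈) → ∉⊥ (proj₁ (∂⁻ G v∈)) }
  Good-small (extend _ _ small _) = small

  -- A path decomposition in which `v` occupies the bags from `l v` to `r v`; `edge`, applied in
  -- both directions, makes the intervals of adjacent vertices overlap. Only core vertices count for
  -- the width, and all others occupy a single bag.
  record Spine (D S : Subset (n G)) (c : ℕ) : Set where
    field
      l r    : V G → ℕ
      core   : Subset (n G)
      core⊆D : core ⊆ D
      order  : ∀ {v} → v ∈ D → l v ≤ r v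
      edge   : ∀ {u v} → u ∈ D → v ∈ D → Adj G u v → l u ≤ r v
      thin   : ∀ {v} → v ∈ D → v ∉ core → l v ≡ r v
      S⊆core : ∀ {v} → v ∈ D → v ∈ S → v ∈ core
      width  : ∀ i Q → (∀ {v} → v ∈ Q → v ∈ core × l v ≤ i × i ≤ r v) → ∣ Q ∣ ≤ c

  -- By `fringe` the boundary of `X` is still present in the last bag `N`, so one further bag can
  -- cover its edges to the outside.
  record Prefix (X S : Subset (n G)) (c : ℕ) : Set where
    field
      spine  : Spine X S c
      N      : ℕ
    open Spine spine public
    field
      bound  : ∀ {v} → v ∈ X → r v ≤ N
      fringe : ∀ {v} → v ∈ ∂ G X → v ∈ core × r v ≡ N

  -- Each extension appends a bag with `∂ G X` and all of `Y ─ X`. Its core vertices lie in `∂ G X`,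
  -- in `∂ G Y` or among the new vertices of `S`, hence three times `p`.
  prefix : ∀ {S p X} → Good G S p X → Prefix X S (p + (p + p))
  prefix start = record
    { spine = record
      { l = λ _ → 0 ; r = λ _ → 0 ; core = ⊥ ; core⊆D = id ; order = λ _ → z≤n ; edge = λ _ _ _ → z≤n
      ; thin = λ _ _ → refl ; S⊆core = λ v∈⊥ → ⊥-elim (∉⊥ v∈⊥)
      ; width = λ i Q Q⊆ → ∣∅∣≤ λ { (_ , v∈Q) → ∉⊥ (proj₁ (Q⊆ v∈Q)) } }
    ; N = 0 ; bound = λ _ → z≤n ; fringe = λ v∈ → ⊥-elim (∉⊥ (proj₁ (∂⁻ G v∈))) }
  prefix {S} {p} (extend {X} {Y} good X⊂Y small few) = record
    { spine = record
      { l = l′ ; r = r′ ; core = core′ ; core⊆D = core′⊆Y ; order = order′ ; edge = edge′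
      ; thin = thin′ ; S⊆core = S⊆core′ ; width = width′ }
    ; N = suc N ; bound = bound′ ; fringe = fringe′ }
    where
    open Prefix (prefix good)
    X⊆Y : X ⊆ Y
    X⊆Y = p⊂q⇒p⊆q X⊂Y
    new = ∂ G Y ∪ (S ∩ (Y ─ X))
    core′ = core ∪ new
    l′ r′ : V G → ℕ
    l′ v with v ∈? X
    ... | yes _ = l v
    ... | no _  = suc N
    r′ v with v ∈? X | v ∈? ∂ G X
    ... | yes _ | yes _ = suc N
    ... | yes _ | no _  = r v
    ... | no _  | _     = suc N
    ∂Y∩X : ∀ {v} → v ∈ X → v ∈ ∂ G Y → v ∈ ∂ G X
    ∂Y∩X v∈X v∈∂Y with ∂⁻ G v∈∂Y
    ... | _ , w , v~w , w∉Y = ∂⁺ G v∈X v~w (w∉Y ∘ X⊆Y)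
    core′⊆Y : core′ ⊆ Y
    core′⊆Y = ∪-lub (X⊆Y ∘ core⊆D) (∪-lub (proj₁ ∘ ∂⁻ G) (proj₁ ∘ ∈─⁻ Y X ∘ p∩q⊆q S _))
    order′ : ∀ {v} → v ∈ Y → l′ v ≤ r′ v
    order′ {v} v∈Y with v ∈? X | v ∈? ∂ G X
    ... | yes v∈X | yes _ = m≤n⇒m≤1+n (≤-trans (order v∈X) (bound v∈X))
    ... | yes v∈X | no _  = order v∈X
    ... | no _    | _     = ≤-refl
    edge′ : ∀ {u v} → u ∈ Y → v ∈ Y → Adj G u v → l′ u ≤ r′ v
    edge′ {u} {v} u∈Y v∈Y u~v with u ∈? X | v ∈? X | v ∈? ∂ G X
    ... | yes u∈X | yes v∈X | yes _ = m≤n⇒m≤1+n (≤-trans (order u∈X) (bound u∈X))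
    ... | yes u∈X | yes v∈X | no _  = edge u∈X v∈X u~v
    ... | yes u∈X | no _    | _     = m≤n⇒m≤1+n (≤-trans (order u∈X) (bound u∈X))
    ... | no u∉X  | yes v∈X | yes _ = ≤-refl
    ... | no u∉X  | yes v∈X | no v∉ = ⊥-elim (v∉ (∂⁺ G v∈X (Adj-sym {G} u~v) u∉X))
    ... | no _    | no _    | _     = ≤-refl
    thin′ : ∀ {v} → v ∈ Y → v ∉ core′ → l′ v ≡ r′ v
    thin′ {v} v∈Y v∉ with v ∈? X | v ∈? ∂ G X
    ... | yes v∈X | yes v∈∂X = ⊥-elim (v∉ (p⊆p∪q _ (proj₁ (fringe v∈∂X))))
    ... | yes v∈X | no _     = thin v∈X (v∉ ∘ p⊆p∪q _)
    ... | no _    | _        = refl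
    S⊆core′ : ∀ {v} → v ∈ Y → v ∈ S → v ∈ core′
    S⊆core′ {v} v∈Y v∈S with v ∈? X
    ... | yes v∈X = p⊆p∪q _ (S⊆core v∈X v∈S)
    ... | no v∉X  = q⊆p∪q core _ (q⊆p∪q (∂ G Y) _ (x∈p∩q⁺ (v∈S , x∈p∧x∉q⇒x∈p─q v∈Y v∉X)))
    bound′ : ∀ {v} → v ∈ Y → r′ v ≤ suc N
    bound′ {v} v∈Y with v ∈? X | v ∈? ∂ G X
    ... | yes _   | yes _ = ≤-refl
    ... | yes v∈X | no _  = m≤n⇒m≤1+n (bound v∈X)
    ... | no _    | _     = ≤-refl
    fringe′ : ∀ {v} → v ∈ ∂ G Y → v ∈ core′ × r′ v ≡ suc N
    fringe′ {v} v∈∂Y = q⊆p∪q core _ (p⊆p∪q _ v∈∂Y) , last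
      where
      last : r′ v ≡ suc N
      last with v ∈? X | v ∈? ∂ G X
      ... | yes _   | yes _  = refl
      ... | yes v∈X | no v∉  = ⊥-elim (v∉ (∂Y∩X v∈X v∈∂Y))
      ... | no _    | _      = refl
    width′ : ∀ i Q → (∀ {v} → v ∈ Q → v ∈ core′ × l′ v ≤ i × i ≤ r′ v) → ∣ Q ∣ ≤ p + (p + p)
    width′ i Q Q⊆ with i ≤? N
    ... | yes i≤N = width i Q λ v∈Q → case Q⊆ v∈Q of λ { (v∈ , l≤i , i≤r) → early v∈ l≤i i≤r }
      where
      early : ∀ {v} → v ∈ core′ → l′ v ≤ i → i ≤ r′ v → v ∈ core × l v ≤ i × i ≤ r v
      early {v} v∈ l≤i i≤r with v ∈? X | v ∈? ∂ G X
      ... | no _    | _        = ⊥-elim (<⇒≱ l≤i i≤N)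
      ... | yes v∈X | yes v∈∂X = proj₁ (fringe v∈∂X) , l≤i ,
              ≤-trans i≤N (≤-reflexive (≡-sym (proj₂ (fringe v∈∂X))))
      ... | yes v∈X | no v∉∂X with x∈p∪q⁻ core _ v∈
      ...   | inj₁ v∈core = v∈core , l≤i , i≤r
      ...   | inj₂ v∈new with x∈p∪q⁻ (∂ G Y) _ v∈new
      ...     | inj₁ v∈∂Y = ⊥-elim (v∉∂X (∂Y∩X v∈X v∈∂Y))
      ...     | inj₂ v∈S─ = ⊥-elim (proj₂ (∈─⁻ Y X (p∩q⊆q S _ v∈S─)) v∈X)
    ... | no i≰N = ≤-trans (p⊆q⇒∣p∣≤∣q∣ {q = ∂ G X ∪ new} λ v∈Q → case Q⊆ v∈Q of
                     λ { (v∈ , _ , i≤r) → late v∈ i≤r })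
                   (≤-trans (∣∪∣≤ (∂ G X) new) (+-mono-≤ (Good-small good)
                     (≤-trans (∣∪∣≤ (∂ G Y) _) (+-mono-≤ small few))))
      where
      late : ∀ {v} → v ∈ core′ → i ≤ r′ v → v ∈ ∂ G X ∪ new
      late {v} v∈ i≤r with v ∈? X | v ∈? ∂ G X
      ... | yes _   | yes v∈∂X = p⊆p∪q _ v∈∂X
      ... | yes v∈X | no _     = ⊥-elim (i≰N (≤-trans i≤r (bound v∈X)))
      ... | no v∉X  | _ with x∈p∪q⁻ core _ v∈
      ...   | inj₁ v∈core = ⊥-elim (v∉X (core⊆D v∈core))
      ...   | inj₂ v∈new  = q⊆p∪q (∂ G X) _ v∈new

  record Attached (a : V G) (D : Subset (n G)) : Set where
    field
      a∉D   : a ∉ D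
      reach : ∀ {v} → v ∈ D → Reach G (_∈ ⊤) v a
      rim   : ∀ {u v} → u ∉ D → v ∈ D → Adj G u v → Reach G (_∈ ∁ D) u a

  module _ {D S : Subset (n G)} {c : ℕ} (sp : Spine D S c) where
    open Spine sp

    Piece? : ∀ k → Decidable (λ v → v ∈ D × v ∉ core × l v ≡ k)
    Piece? k v = v ∈? D ×-dec ¬? (v ∈? core) ×-dec l v ≟ℕ k

    piece : ℕ → Subset (n G)
    piece k = ⟪ Piece? k ⟫

    piece⁺ : ∀ {k v} → v ∈ D → v ∉ core → l v ≡ k → v ∈ piece k
    piece⁺ {k} v∈D v∉ e = ∈⟪⟫⁺ (Piece? k) (v∈D , v∉ , e)

    piece⁻ : ∀ {k v} → v ∈ piece k → v ∈ D × v ∉ core × l v ≡ k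
    piece⁻ {k} = ∈⟪⟫⁻ (Piece? k)

    -- What a piece needs in order to be `Attached` beyond what it inherits from `D`: the vertices
    -- of `D` around it reach `a` without passing through it.
    Clean : V G → Set
    Clean a = ∀ {v} → v ∈ D → v ∉ core → ∀ {u} → u ∈ D → u ∉ piece (l v) →
              Reach G (_∈ ∁ (piece (l v))) u a

    ∁-piece : ∀ {k u a} → Reach G (_∈ ∁ D) u a → Reach G (_∈ ∁ (piece k)) u a
    ∁-piece = Reach-mono λ x x∈ → x∉p⇒x∈∁p (x∈∁p⇒x∉p x∈ ∘ proj₁ ∘ piece⁻)

    piece-attached : ∀ {a k v} → Attached a D → Clean a → v ∈ piece k → Attached a (piece k)
    piece-attached {a} {k} att clean v∈ with piece⁻ v∈
    ... | v∈D , v∉core , refl = record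
      { a∉D = att.a∉D ∘ proj₁ ∘ piece⁻
      ; reach = att.reach ∘ proj₁ ∘ piece⁻
      ; rim = λ {u} u∉ w∈ u~w → case u ∈? D of λ
          { (yes u∈D) → clean v∈D v∉core u∈D u∉
          ; (no u∉D)  → ∁-piece (att.rim u∉D (proj₁ (piece⁻ w∈)) u~w) } }
      where module att = Attached att

  -- A set M cut off from a by the piece at k is moved into that piece.
  cleanSpine : ∀ {a D c} → Attached a D → Spine D (∂ G D) c → Σ (Spine D (∂ G D) c) λ sp → Clean sp a
  cleanSpine {a} {D} {c} att sp₀ = go ∣ Spine.core sp₀ ∣ sp₀ ≤-refl
    where
    module att = Attached att
    go : ∀ fuel (sp : Spine D (∂ G D) c) → ∣ Spine.core sp ∣ ≤ fuel →
         Σ (Spine D (∂ G D) c) λ sp → Clean sp a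
    go fuel sp size with any? (λ v → v ∈? D ×-dec ¬? (v ∈? Spine.core sp) ×-dec
      any? λ u → u ∈? D ×-dec ¬? (u ∈? piece sp (Spine.l sp v)) ×-dec
        ¬? (Reach? (∁ (piece sp (Spine.l sp v))) u a))
    ... | no ¬bad = sp , λ {v} v∈D v∉core {u} u∈D u∉ →
            decidable-stable (Reach? _ u a) λ ¬r → ¬bad (v , v∈D , v∉core , u , u∈D , u∉ , ¬r)
    ... | yes (v , v∈D , v∉core , u , u∈D , u∉ , ¬r) = recurse fuel size
      where
      open Spine sp
      κ = l v
      E = piece sp κ
      M? : Decidable (λ x → x ∈ D × x ∉ E × ¬ Reach G (_∈ ∁ E) x a)
      M? x = x ∈? D ×-dec ¬? (x ∈? E) ×-dec ¬? (Reach? (∁ E) x a)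
      M = ⟪ M? ⟫
      M⁻ : ∀ {x} → x ∈ M → x ∈ D × x ∉ E × ¬ Reach G (_∈ ∁ E) x a
      M⁻ = ∈⟪⟫⁻ M?
      E-at : ∀ {x} → x ∈ E → l x ≡ κ × r x ≡ κ
      E-at x∈ with piece⁻ sp x∈
      ... | x∈D , x∉core , e = e , trans (≡-sym (thin x∈D x∉core)) e
      M-step : ∀ {x y} → x ∈ M → y ∈ D → Adj G x y → y ∉ M → y ∈ E
      M-step {x} {y} x∈M y∈D x~y y∉M with y ∈? E | Reach? (∁ E) y a
      ... | yes y∈E | _      = y∈E
      ... | no y∉E  | yes ry = ⊥-elim (proj₂ (proj₂ (M⁻ x∈M))
                                 (step (x∉p⇒x∈∁p (proj₁ (proj₂ (M⁻ x∈M)))) x~y ry))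
      ... | no y∉E  | no ¬ry = ⊥-elim (y∉M (∈⟪⟫⁺ M? (y∈D , y∉E , ¬ry)))
      -- A boundary vertex has a neighbour outside `D`, which by `rim` reaches `a` outside `D` and
      -- so without meeting `E`.
      ∂D∩M : ∀ {x} → x ∈ ∂ G D → x ∉ M
      ∂D∩M x∈ x∈M with ∂⁻ G x∈
      ... | x∈D , w , x~w , w∉D = proj₂ (proj₂ (M⁻ x∈M))
              (step (x∉p⇒x∈∁p (proj₁ (proj₂ (M⁻ x∈M)))) x~w
                (∁-piece sp (att.rim w∉D x∈D (Adj-sym {G} x~w))))
      l′ r′ : V G → ℕ
      l′ x with x ∈? M
      ... | yes _ = κ
      ... | no _  = l x
      r′ x with x ∈? M
      ... | yes _ = κ
      ... | no _  = r x
      order′ : ∀ {x} → x ∈ D → l′ x ≤ r′ x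
      order′ {x} x∈D with x ∈? M
      ... | yes _ = ≤-refl
      ... | no _  = order x∈D
      -- Edges of `D` that leave `M` end in `E`, which lives in bag `κ` just as `M` now does.
      edge′ : ∀ {x y} → x ∈ D → y ∈ D → Adj G x y → l′ x ≤ r′ y
      edge′ {x} {y} x∈D y∈D x~y with x ∈? M | y ∈? M
      ... | yes _   | yes _   = ≤-refl
      ... | yes x∈M | no y∉M  = ≤-reflexive (≡-sym (proj₂ (E-at (M-step x∈M y∈D x~y y∉M))))
      ... | no x∉M  | yes y∈M = ≤-reflexive (proj₁ (E-at (M-step y∈M x∈D (Adj-sym {G} x~y) x∉M)))
      ... | no _    | no _    = edge x∈D y∈D x~y
      thin′ : ∀ {x} → x ∈ D → x ∉ core ─ M → l′ x ≡ r′ x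
      thin′ {x} x∈D x∉ with x ∈? M
      ... | yes _   = refl
      ... | no x∉M  = thin x∈D λ x∈core → x∉ (x∈p∧x∉q⇒x∈p─q x∈core x∉M)
      width′ : ∀ i Q → (∀ {x} → x ∈ Q → x ∈ core ─ M × l′ x ≤ i × i ≤ r′ x) → ∣ Q ∣ ≤ c
      width′ i Q Q⊆ = width i Q λ x∈Q → case Q⊆ x∈Q of λ { (x∈ , l≤i , i≤r) → old x∈ l≤i i≤r }
        where
        old : ∀ {x} → x ∈ core ─ M → l′ x ≤ i → i ≤ r′ x → x ∈ core × l x ≤ i × i ≤ r x
        old {x} x∈ l≤i i≤r with x ∈? M
        ... | yes x∈M = ⊥-elim (proj₂ (∈─⁻ core M x∈) x∈M)
        ... | no _    = proj₁ (∈─⁻ core M x∈) , l≤i , i≤r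
      sp′ : Spine D (∂ G D) c
      sp′ = record
        { l = l′ ; r = r′ ; core = core ─ M ; core⊆D = core⊆D ∘ proj₁ ∘ ∈─⁻ core M
        ; order = order′ ; edge = edge′ ; thin = thin′
        ; S⊆core = λ x∈D x∈∂D → x∈p∧x∉q⇒x∈p─q (S⊆core x∈D x∈∂D) (∂D∩M x∈∂D)
        ; width = width′ }
      -- Termination: the core loses a vertex. An edge leaving `M` ends in `E`, so its end in `M`,
      -- were it not in the core, would share the single bag `κ` and belong to `E`.
      meets : Nonempty (core ∩ M)
      meets with exit M (att.reach u∈D) (∈⟪⟫⁺ M? (u∈D , u∉ , ¬r)) (att.a∉D ∘ proj₁ ∘ M⁻)
      ... | x , y , x∈M , y∉M , x~y with y ∈? D
      ...   | no y∉D = ⊥-elim (∂D∩M (∂⁺ G (proj₁ (M⁻ x∈M)) x~y y∉D) x∈M)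
      ...   | yes y∈D = x , x∈p∩q⁺ (decidable-stable (x ∈? core) x∈core , x∈M)
        where
        x∈D = proj₁ (M⁻ x∈M)
        y∈E = M-step x∈M y∈D x~y y∉M
        x∈core : ¬ x ∉ core
        x∈core x∉core = proj₁ (proj₂ (M⁻ x∈M)) (piece⁺ sp x∈D x∉core (≤-antisym
          (≤-trans (edge x∈D y∈D x~y) (≤-reflexive (proj₂ (E-at y∈E))))
          (≤-trans (≤-reflexive (≡-sym (proj₁ (E-at y∈E))))
            (≤-trans (edge y∈D x∈D (Adj-sym {G} x~y)) (≤-reflexive (≡-sym (thin x∈D x∉core)))))))
      recurse : ∀ fuel → ∣ core ∣ ≤ fuel → Σ (Spine D (∂ G D) c) λ sp → Clean sp a
      recurse zero       size = ⊥-elim (n≮0 (≤-trans (p∩q≢∅⇒∣p─q∣<∣p∣ core M meets) size))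
      recurse (suc fuel) size = go fuel sp′ (s≤s⁻¹ (≤-trans (p∩q≢∅⇒∣p─q∣<∣p∣ core M meets) size))

-- Layered path layouts

below-max : ∀ {n} (f : Fin n → ℕ) → ∃ λ N → ∀ v → f v ≤ N
below-max {zero}  f = 0 , λ ()
below-max {suc n} f with below-max (f ∘ suc)
... | N , f≤ = f zero ⊔ N , λ { zero → m≤m⊔n _ _ ; (suc v) → ≤-trans (f≤ v) (m≤n⊔m _ _) }

leastFin : ∀ {n} {P : Fin n → Set} → Decidable P → ∃ P → ∃ λ v → P v × (∀ w → P w → toℕ v ≤ toℕ w)
leastFin {suc n} P? (v , Pv) with P? zero
... | yes P0 = zero , P0 , λ _ _ → z≤n
leastFin {suc n} P? (zero  , Pv) | no ¬P0 = ⊥-elim (¬P0 Pv)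
leastFin {suc n} P? (suc v , Pv) | no ¬P0 with leastFin (P? ∘ suc) (v , Pv)
... | w , Pw , min = suc w , Pw , λ { zero P0 → ⊥-elim (¬P0 P0) ; (suc u) Pu → s≤s (min u Pu) }

block-≤ : ∀ M {s t a b} → s + a * M ≤ t + b * M → t < M → a ≤ b
block-≤ M {s} {t} {a} {b} le t<M = ≮⇒≥ λ b<a → <⇒≱ (+-monoˡ-< (b * M) t<M)
  (≤-trans (*-monoˡ-≤ M b<a) (≤-trans (m≤n+m _ s) le))

module _ (G : Graph) where

  -- `border` is the gluing condition: vertices with neighbours outside `D` stay in the top layer,
  -- next to the layer in which the surrounding core will lie.
  record Layout (D : Subset (n G)) (c : ℕ) : Set where
    field
      L l r  : V G → ℕ
      N      : ℕ
      order  : ∀ {v} → v ∈ D → l v ≤ r v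
      bound  : ∀ {v} → v ∈ D → r v ≤ N
      edge   : ∀ {u v} → u ∈ D → v ∈ D → Adj G u v → l u ≤ r v
      layer  : ∀ {u v} → u ∈ D → v ∈ D → Adj G u v → L u ≤ suc (L v)
      border : ∀ {v} → v ∈ ∂ G D → L v ≡ 0
      width  : ∀ i j Q → (∀ {v} → v ∈ Q → v ∈ D × l v ≤ i × i ≤ r v × L v ≡ j) → ∣ Q ∣ ≤ c

  emptyLayout : ∀ {D c} → ¬ Nonempty D → Layout D c
  emptyLayout ¬ne = record
    { L = λ _ → 0 ; l = λ _ → 0 ; r = λ _ → 0 ; N = 0 ; order = λ _ → z≤n ; bound = λ _ → z≤n
    ; edge = λ _ _ _ → z≤n ; layer = λ _ _ _ → z≤n ; border = λ _ → refl
    ; width = λ i j Q Q⊆ → ∣∅∣≤ λ { (v , v∈Q) → ¬ne (v , proj₁ (Q⊆ v∈Q)) } }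

  -- The bag of the spine at k becomes a block of M consecutive bags accommodating the layout of
  -- the piece at k, whose layers are shifted by one.
  combine : ∀ {D c} (sp : Spine G D (∂ G D) c) → (∀ k → Layout (piece G sp k) c) → Layout D c
  combine {D} {c} sp res = record
    { L = L′ ; l = l′ ; r = r′ ; N = proj₁ (below-max r′) ; order = λ {v} → order′ {v}
    ; bound = λ {v} _ → proj₂ (below-max r′) v ; edge = edge′ ; layer = layer′ ; border = border′
    ; width = width′ }
    where
    open Spine sp
    module R κ = Layout (res κ)
    -- A common block length, sufficient for the layouts of all nonempty pieces.
    M′ M : ℕ
    M′ = proj₁ (below-max λ v → R.N (l v))
    M = suc M′
    L′ l′ r′ : V G → ℕ
    L′ v with v ∈? core
    ... | yes _ = 0
    ... | no _  = suc (R.L (l v) v)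
    l′ v with v ∈? core
    ... | yes _ = 0 + l v * M
    ... | no _  = R.l (l v) v + l v * M
    r′ v with v ∈? core
    ... | yes _ = M′ + r v * M
    ... | no _  = R.r (l v) v + l v * M
    own : ∀ {v} → v ∈ D → v ∉ core → v ∈ piece G sp (l v)
    own v∈D v∉ = piece⁺ G sp v∈D v∉ refl
    r≤M′ : ∀ {v} → v ∈ D → v ∉ core → R.r (l v) v ≤ M′
    r≤M′ v∈D v∉ = ≤-trans (R.bound _ (own v∈D v∉)) (proj₂ (below-max λ v → R.N (l v)) _)
    same : ∀ {u v} → u ∈ D → v ∈ D → u ∉ core → v ∉ core → Adj G u v → l u ≡ l v
    same u∈D v∈D u∉ v∉ u~v = ≤-antisym
      (≤-trans (edge u∈D v∈D u~v) (≤-reflexive (≡-sym (thin v∈D v∉))))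
      (≤-trans (edge v∈D u∈D (Adj-sym {G} u~v)) (≤-reflexive (≡-sym (thin u∈D u∉))))
    order′ : ∀ {v} → v ∈ D → l′ v ≤ r′ v
    order′ {v} v∈D with v ∈? core
    ... | yes _ = ≤-trans (*-monoˡ-≤ M (order v∈D)) (m≤n+m _ M′)
    ... | no v∉ = +-monoˡ-≤ _ (R.order _ (own v∈D v∉))
    edge′ : ∀ {u v} → u ∈ D → v ∈ D → Adj G u v → l′ u ≤ r′ v
    edge′ {u} {v} u∈D v∈D u~v with u ∈? core | v ∈? core
    ... | yes _ | yes _ = ≤-trans (*-monoˡ-≤ M (edge u∈D v∈D u~v)) (m≤n+m _ M′)
    ... | yes _ | no v∉ = ≤-trans (*-monoˡ-≤ M (≤-trans (edge u∈D v∈D u~v)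
                            (≤-reflexive (≡-sym (thin v∈D v∉))))) (m≤n+m _ _)
    ... | no u∉ | yes _ = +-mono-≤ (≤-trans (R.order _ (own u∈D u∉)) (r≤M′ u∈D u∉))
                            (*-monoˡ-≤ M (edge u∈D v∈D u~v))
    ... | no u∉ | no v∉ with same u∈D v∈D u∉ v∉ u~v
    ...   | e = subst (λ κ → R.l (l u) u + l u * M ≤ R.r κ v + κ * M) e
                  (+-monoˡ-≤ _ (R.edge (l u) (own u∈D u∉) (piece⁺ G sp v∈D v∉ (≡-sym e)) u~v))
    layer′ : ∀ {u v} → u ∈ D → v ∈ D → Adj G u v → L′ u ≤ suc (L′ v)
    layer′ {u} {v} u∈D v∈D u~v with u ∈? core | v ∈? core
    ... | yes _ | _        = z≤n
    ... | no u∉ | yes v∈   = s≤s (≤-reflexive (R.border (l u) (∂⁺ G (own u∈D u∉) u~v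
                               λ v∈piece → proj₁ (proj₂ (piece⁻ G sp v∈piece)) v∈)))
    ... | no u∉ | no v∉ with same u∈D v∈D u∉ v∉ u~v
    ...   | e = subst (λ κ → suc (R.L (l u) u) ≤ suc (suc (R.L κ v))) e
                  (s≤s (R.layer (l u) (own u∈D u∉) (piece⁺ G sp v∈D v∉ (≡-sym e)) u~v))
    border′ : ∀ {v} → v ∈ ∂ G D → L′ v ≡ 0
    border′ {v} v∈ with v ∈? core
    ... | yes _ = refl
    ... | no v∉ = ⊥-elim (v∉ (S⊆core (proj₁ (∂⁻ G v∈)) v∈))
    width′ : ∀ i j Q → (∀ {v} → v ∈ Q → v ∈ D × l′ v ≤ i × i ≤ r′ v × L′ v ≡ j) → ∣ Q ∣ ≤ c
    width′ i j Q Q⊆ = split j Q⊆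
      where
      κ = i / M
      t = i % M
      t<M : t < M
      t<M = m%n<n i M
      i≡ : i ≡ t + κ * M
      i≡ = m≡m%n+[m/n]*n i M
      -- In a bag of block `κ`, layer 0 consists of core vertices from bag `κ` of the spine, and
      -- every deeper layer belongs to the piece at `κ` alone. So the two bounds are never added.
      split : ∀ j → (∀ {v} → v ∈ Q → v ∈ D × l′ v ≤ i × i ≤ r′ v × L′ v ≡ j) → ∣ Q ∣ ≤ c
      split zero Q⊆ = width κ Q λ v∈Q → case Q⊆ v∈Q of λ { (v∈D , l≤i , i≤r , L≡0) →
          in-core l≤i i≤r L≡0 }
        where
        in-core : ∀ {v} → l′ v ≤ i → i ≤ r′ v → L′ v ≡ 0 → v ∈ core × l v ≤ κ × κ ≤ r v
        in-core {v} l≤i i≤r L≡0 with v ∈? core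
        ... | yes v∈ = v∈ , block-≤ M (subst (l v * M ≤_) i≡ l≤i) t<M ,
                       block-≤ M (subst (_≤ M′ + r v * M) i≡ i≤r) ≤-refl
        in-core {v} l≤i i≤r () | no _
      split (suc j) Q⊆ = R.width κ t j Q λ v∈Q → case Q⊆ v∈Q of λ { (v∈D , l≤i , i≤r , L≡) →
          in-piece v∈D l≤i i≤r L≡ }
        where
        in-piece : ∀ {v} → v ∈ D → l′ v ≤ i → i ≤ r′ v → L′ v ≡ suc j →
                   v ∈ piece G sp κ × R.l κ v ≤ t × t ≤ R.r κ v × R.L κ v ≡ j
        in-piece {v} v∈D l≤i i≤r L≡ with v ∈? core
        in-piece {v} v∈D l≤i i≤r () | yes _
        ... | no v∉ = piece⁺ G sp v∈D v∉ lv≡κ ,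
              +-cancelʳ-≤ (κ * M) _ _ (subst (λ q → R.l q v + q * M ≤ t + κ * M) lv≡κ l≤i′) ,
              +-cancelʳ-≤ (κ * M) _ _ (subst (λ q → t + κ * M ≤ R.r q v + q * M) lv≡κ i≤r′) ,
              suc-injective (subst (λ q → suc (R.L q v) ≡ suc j) lv≡κ L≡)
          where
          l≤i′ = subst (R.l (l v) v + l v * M ≤_) i≡ l≤i
          i≤r′ = subst (_≤ R.r (l v) v + l v * M) i≡ i≤r
          lv≡κ : l v ≡ κ
          lv≡κ = ≤-antisym (block-≤ M l≤i′ t<M) (block-≤ M i≤r′ (s≤s (r≤M′ v∈D v∉)))

  -- The vertex set is kept, so that subsets and labellings carry over unchanged; vertices outside
  -- `D` become isolated.
  restrict : Subset (n G) → Graph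
  restrict D = record
    { n = n G
    ; adj = λ u v → adj G u v ∧ (lookup D u ∧ lookup D v)
    ; sym = λ u v → trans (cong (_∧ _) (Graph.sym G u v)) (cong (adj G v u ∧_) (Bool.∧-comm (lookup D u) _))
    ; loopless = λ v → cong (_∧ _) (loopless G v) }

  restrict⁺ : ∀ {D u v} → u ∈ D → v ∈ D → Adj G u v → Adj (restrict D) u v
  restrict⁺ {D} {u} {v} u∈ v∈ a rewrite a | []=⇒lookup u∈ | []=⇒lookup v∈ = refl

  restrict⁻ : ∀ {D u v} → Adj (restrict D) u v → u ∈ D × Adj G u v
  restrict⁻ {D} {u} {v} e with adj G u v | lookup D u in eq
  ... | true | true = lookup⇒[]= u D eq , refl
  restrict⁻ () | true  | false
  restrict⁻ () | false | _

  restrict-Reach : ∀ {D} {U : V G → Set} {u v} → Reach (restrict D) U u v → Reach G U u v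
  restrict-Reach (here s)     = here s
  restrict-Reach {D} (step s a p) = step s (proj₂ (restrict⁻ {D} a)) (restrict-Reach {D} p)

  restrict-Spine : ∀ {D S c} → Spine (restrict D) ⊤ S c → Spine G D S c
  restrict-Spine {D} {S} {c} sp = record
    { l = l ; r = r ; core = core ∩ D ; core⊆D = p∩q⊆q core D
    ; order = λ _ → order ∈⊤
    ; edge = λ u∈ v∈ a → edge ∈⊤ ∈⊤ (restrict⁺ u∈ v∈ a)
    ; thin = λ v∈D v∉ → thin ∈⊤ λ v∈core → v∉ (x∈p∩q⁺ (v∈core , v∈D))
    ; S⊆core = λ v∈D v∈S → x∈p∩q⁺ (S⊆core ∈⊤ v∈S , v∈D)
    ; width = λ i Q Q⊆ → width i Q λ v∈Q → case Q⊆ v∈Q of λ { (v∈ , le) → p∩q⊆p core D v∈ , le } }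
    where open Spine sp

  Reach-within : ∀ {U : V G → Set} {u a} → Reach G U u a → Reach G (λ x → Reach G U x a) u a
  Reach-within (here s)     = here (here s)
  Reach-within (step s e p) = step (step s e p) e (Reach-within p)

  -- From rooted models to minors with an apex

  module _ {H : Graph} {h₀ : V H} {a : V G} {D : Subset (n G)} (att : Attached G a D) {p : ℕ}
           (ℛ : RootedModel (restrict D) (∂ G D) p H (∁ ⁅ h₀ ⁆)) where

    private
      module att = Attached att
      module ℛ = RootedModel ℛ
      module ℳ = PartialModel ℛ.model

      other : ∀ {h} → h ≢ h₀ → h ∈ ∁ ⁅ h₀ ⁆
      other h≢ = x∉p⇒x∈∁p (h≢ ∘ x∈⁅y⁆⇒x≡y h₀)

      other⁻ : h₀ ∉ ∁ ⁅ h₀ ⁆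
      other⁻ h₀∈ = x∈∁p⇒x∉p h₀∈ (x∈⁅x⁆ h₀)

      first : ∀ {S : V G → Set} {u v} → Reach (restrict D) S u v → v ∈ D → u ∈ D
      first (here _)     v∈D = v∈D
      first (step _ e _) _   = proj₁ (restrict⁻ {D} e)

      -- A branch set is connected in `restrict D` and contains a root in `D`, so it has no vertex
      -- among the isolated ones.
      φ⊆D : ∀ {v h} → ℛ.φ v ≡ just h → v ∈ D
      φ⊆D e with ℛ.root (ℳ.support e)
      ... | s , φs , s∈∂D = first (ℳ.connected e φs) (proj₁ (∂⁻ G s∈∂D))

      A : V G → Set
      A v = Reach G (_∈ ∁ D) v a

      ψ : V G → Maybe (V H)
      ψ v with v ∈? D | Reach? G (∁ D) v a
      ... | yes _ | _     = ℛ.φ v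
      ... | no _  | yes _ = just h₀
      ... | no _  | no _  = nothing

      φ⇒ψ : ∀ {v h} → ℛ.φ v ≡ just h → ψ v ≡ just h
      φ⇒ψ {v} e with v ∈? D | Reach? G (∁ D) v a
      ... | yes _ | _ = e
      ... | no v∉ | _ = ⊥-elim (v∉ (φ⊆D e))

      A⇒ψ : ∀ {v} → A v → ψ v ≡ just h₀
      A⇒ψ {v} q with v ∈? D | Reach? G (∁ D) v a
      ... | yes v∈ | _     = ⊥-elim (x∈∁p⇒x∉p (Reach-head q) v∈)
      ... | no _   | yes _ = refl
      ... | no _   | no ¬q = ⊥-elim (¬q q)

      ψ⁻ : ∀ {v h} → ψ v ≡ just h → ℛ.φ v ≡ just h ⊎ (A v × h ≡ h₀)
      ψ⁻ {v} e with v ∈? D | Reach? G (∁ D) v a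
      ... | yes _ | _     = inj₁ e
      ψ⁻ {v} refl | no _  | yes q = inj₂ (q , refl)

      A-rim : ∀ {h} → h ≢ h₀ → ∃ λ s → ∃ λ w → ℛ.φ s ≡ just h × A w × Adj G s w
      A-rim h≢ with ℛ.root (other h≢)
      ... | s , φs , s∈∂D with ∂⁻ G s∈∂D
      ...   | s∈D , w , s~w , w∉D = s , w , φs , att.rim w∉D s∈D (Adj-sym {G} s~w) , s~w

    apexMinor : H ≼ G
    apexMinor = record
      { φ = ψ ; nonempty = nonempty ; connected = connected ; edges = edges }
      where
      nonempty : ∀ h → ∃ λ g → ψ g ≡ just h
      nonempty h with h Fin.≟ h₀
      ... | yes refl = a , A⇒ψ (here (x∉p⇒x∈∁p att.a∉D))
      ... | no h≢ with ℛ.root (other h≢)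
      ...   | s , φs , _ = s , φ⇒ψ φs
      connected : ∀ h g g′ → ψ g ≡ just h → ψ g′ ≡ just h → Reach G (λ x → ψ x ≡ just h) g g′
      connected h g g′ e e′ with ψ⁻ e | ψ⁻ e′
      ... | inj₁ φg | inj₁ φg′ =
              Reach-mono (λ _ → φ⇒ψ) (restrict-Reach {D} (ℳ.connected φg φg′))
      ... | inj₁ φg | inj₂ (_ , refl) = ⊥-elim (other⁻ (ℳ.support φg))
      ... | inj₂ (_ , refl) | inj₁ φg′ = ⊥-elim (other⁻ (ℳ.support φg′))
      ... | inj₂ (q , refl) | inj₂ (q′ , _) =
              Reach-mono (λ _ → A⇒ψ) (Reach-trans (Reach-within q) (Reach-sym (Reach-within q′)))
      edges : ∀ h h′ → Adj H h h′ →
              ∃ λ g → ∃ λ g′ → ψ g ≡ just h × ψ g′ ≡ just h′ × Adj G g g′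
      edges h h′ h~h′ with h Fin.≟ h₀ | h′ Fin.≟ h₀
      ... | yes refl | yes refl = contradiction (trans (≡-sym h~h′) (loopless H h)) λ ()
      ... | yes refl | no h′≢ with A-rim h′≢
      ...   | s , w , φs , q , s~w = w , s , A⇒ψ q , φ⇒ψ φs , Adj-sym {G} s~w
      edges h h′ h~h′ | no h≢ | yes refl with A-rim h≢
      ...   | s , w , φs , q , s~w = s , w , φ⇒ψ φs , A⇒ψ q , s~w
      edges h h′ h~h′ | no h≢ | no h′≢ with ℳ.edges (other h≢) (other h′≢) h~h′
      ...   | g , g′ , φg , φg′ , a′ = g , g′ , φ⇒ψ φg , φ⇒ψ φg′ , proj₂ (restrict⁻ {D} a′)

  -- Layouts in the absence of the minor

  module _ {H : Graph} {h₀ : V H} (peel : Peelable H (∁ ⁅ h₀ ⁆)) (¬H≼G : ¬ H ≼ G) where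

    private
      c : ℕ
      c = n H + (n H + n H)

    attachedLayout : ∀ fuel a D → ∣ D ∣ ≤ fuel → Attached G a D → Layout D c
    attachedLayout fuel a D size att with nonempty? D
    ... | no ¬ne = emptyLayout ¬ne
    ... | yes (d , d∈D) with rooted (restrict D) (∂ G D) (n H) a h₀ peel (∣p∣≤n (∁ ⁅ h₀ ⁆))
    ...   | inj₂ ℛ = ⊥-elim (¬H≼G (apexMinor att ℛ))
    ...   | inj₁ good with cleanSpine G att
                             (restrict-Spine {D} (Prefix.spine (prefix (restrict D) good)))
    ...     | sp , clean = combine sp (pieces fuel size)
      where
      -- A walk from `D` to `a` leaves `D` at a boundary vertex, which is in the core and hence in
      -- no piece.
      smaller : ∀ κ → ∣ piece G sp κ ∣ < ∣ D ∣
      smaller κ with exit G D (Attached.reach att d∈D) d∈D (Attached.a∉D att)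
      ... | x , y , x∈D , y∉D , x~y = p⊂q⇒∣p∣<∣q∣ (⊂-intro (proj₁ ∘ piece⁻ G sp) x∈D
              λ x∈ → proj₁ (proj₂ (piece⁻ G sp x∈)) (Spine.S⊆core sp x∈D (∂⁺ G x∈D x~y y∉D)))
      pieces : ∀ fuel → ∣ D ∣ ≤ fuel → ∀ κ → Layout (piece G sp κ) c
      pieces fuel size κ with nonempty? (piece G sp κ)
      pieces fuel size κ       | no ¬ne = emptyLayout ¬ne
      pieces zero size κ       | yes _  = ⊥-elim (n≮0 (≤-trans (smaller κ) size))
      pieces (suc fuel) size κ | yes (_ , v∈) = attachedLayout fuel a (piece G sp κ)
        (s≤s⁻¹ (≤-trans (smaller κ) size)) (piece-attached G sp att clean v∈)

    -- No vertex is left outside `⊤` to serve as `a`. The top spine therefore has a bag for each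
    -- component, with one representative as its core, and the rest of the component is attached to
    -- that representative.
    layout : Layout ⊤ c
    layout = combine sp pieces
      where
      joined? : ∀ v → Decidable (λ w → Reach G (_∈ ⊤) v w)
      joined? v w = Reach? G ⊤ v w
      least : ∀ v → ∃ λ w → Reach G (_∈ ⊤) v w × (∀ u → Reach G (_∈ ⊤) v u → toℕ w ≤ toℕ u)
      least v = leastFin (joined? v) (v , here ∈⊤)
      rep : V G → V G
      rep v = proj₁ (least v)
      rep-joined : ∀ v → Reach G (_∈ ⊤) v (rep v)
      rep-joined v = proj₁ (proj₂ (least v))
      rep-cong : ∀ {u v} → Reach G (_∈ ⊤) u v → rep u ≡ rep v
      rep-cong {u} {v} q = Fin.toℕ-injective (≤-antisym
        (proj₂ (proj₂ (least u)) _ (Reach-trans q (rep-joined v)))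
        (proj₂ (proj₂ (least v)) _ (Reach-trans (Reach-sym q) (rep-joined u))))
      adj-cong : ∀ {u v} → Adj G u v → rep u ≡ rep v
      adj-cong u~v = rep-cong (step ∈⊤ u~v (here ∈⊤))
      Rep? : Decidable (λ v → rep v ≡ v)
      Rep? v = rep v Fin.≟ v
      sp : Spine G ⊤ (∂ G ⊤) c
      sp = record
        { l = toℕ ∘ rep ; r = toℕ ∘ rep ; core = ⟪ Rep? ⟫ ; core⊆D = ⊆⊤
        ; order = λ _ → ≤-refl
        ; edge = λ _ _ u~v → ≤-reflexive (cong toℕ (adj-cong u~v))
        ; thin = λ _ _ → refl
        ; S⊆core = λ _ v∈ → case ∂⁻ G v∈ of λ { (_ , _ , _ , w∉) → ⊥-elim (w∉ ∈⊤) }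
        ; width = width }
        where
        width : ∀ i Q → (∀ {v} → v ∈ Q → v ∈ ⟪ Rep? ⟫ × toℕ (rep v) ≤ i × i ≤ toℕ (rep v)) → ∣ Q ∣ ≤ c
        width i Q Q⊆ with nonempty? Q
        ... | no ¬ne = ∣∅∣≤ ¬ne
        -- The index of a bag determines its representative, and `c` is positive because `h₀` is a
        -- vertex of `H`.
        ... | yes (v , v∈Q) = ≤-trans (p⊆q⇒∣p∣≤∣q∣ Q⊆v)
                (≤-trans (≤-reflexive (∣⁅x⁆∣≡1 v)) (≤-trans (≤-trans (s≤s z≤n) (Fin.toℕ<n h₀)) (m≤m+n _ _)))
          where
          at : ∀ {u} → u ∈ Q → toℕ u ≡ i
          at {u} u∈Q with Q⊆ u∈Q
          ... | u∈ , l≤i , i≤r = trans (cong toℕ (≡-sym (∈⟪⟫⁻ Rep? u∈))) (≤-antisym l≤i i≤r)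
          Q⊆v : Q ⊆ ⁅ v ⁆
          Q⊆v u∈Q = subst (_∈ ⁅ v ⁆) (Fin.toℕ-injective (trans (at v∈Q) (≡-sym (at u∈Q)))) (x∈⁅x⁆ v)
      attached : ∀ {κ v} → v ∈ piece G sp κ → Attached G (rep v) (piece G sp κ)
      attached {κ} {v} v∈ with piece⁻ G sp v∈
      ... | _ , v∉core , refl = record
        { a∉D = a∉ ; reach = λ w∈ → subst (Reach G (_∈ ⊤) _) (rep-≡ w∈) (rep-joined _)
        ; rim = rim }
        where
        a∉ : rep v ∉ piece G sp κ
        a∉ a∈ = proj₁ (proj₂ (piece⁻ G sp a∈)) (∈⟪⟫⁺ Rep? (≡-sym (rep-cong (rep-joined v))))
        rep-≡ : ∀ {w} → w ∈ piece G sp κ → rep w ≡ rep v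
        rep-≡ w∈ = Fin.toℕ-injective (proj₂ (proj₂ (piece⁻ G sp w∈)))
        -- An outer neighbour of the piece lies in the same component, so it can only be the
        -- representative.
        rim : ∀ {u w} → u ∉ piece G sp κ → w ∈ piece G sp κ → Adj G u w →
              Reach G (_∈ ∁ (piece G sp κ)) u (rep v)
        rim {u} u∉ w∈ u~w with Rep? u
        ... | yes rep-u = subst (λ x → Reach G (_∈ ∁ (piece G sp κ)) x (rep v))
                (trans (≡-sym (trans (adj-cong u~w) (rep-≡ w∈))) rep-u) (here (x∉p⇒x∈∁p a∉))
        ... | no ¬rep-u = ⊥-elim (u∉ (piece⁺ G sp ∈⊤ (¬rep-u ∘ ∈⟪⟫⁻ Rep?)
                (cong toℕ (trans (adj-cong u~w) (rep-≡ w∈)))))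
      pieces : ∀ κ → Layout (piece G sp κ) c
      pieces κ with nonempty? (piece G sp κ)
      ... | no ¬ne = emptyLayout ¬ne
      ... | yes (v , v∈) = attachedLayout _ (rep v) (piece G sp κ) ≤-refl (attached v∈)

-- From layouts to layered path decompositions

count-tabulate : ∀ {m} (f : Fin m → Bool) → count f ≡ ∣ tabulate f ∣
count-tabulate f = trans (cong sum (List.map-tabulate id (λ v → if f v then 1 else 0))) (go f)
  where
  go : ∀ {m} (f : Fin m → Bool) → sum (List.tabulate (λ v → if f v then 1 else 0)) ≡ ∣ tabulate f ∣
  go {zero}  f = refl
  go {suc m} f with f zero
  ... | true  = cong suc (go (f ∘ suc))
  ... | false = go (f ∘ suc)

≡ᵇ-true⁺ : ∀ {i j} → i ≡ j → (i ≡ᵇ j) ≡ true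
≡ᵇ-true⁺ {i} {j} e = Equivalence.to Bool.T-≡ (≡⇒≡ᵇ i j e)

≡ᵇ-true⁻ : ∀ {i j} → (i ≡ᵇ j) ≡ true → i ≡ j
≡ᵇ-true⁻ {i} {j} e = ≡ᵇ⇒≡ i j (Equivalence.from Bool.T-≡ e)

∧-true⁻ : ∀ {x y} → x ∧ y ≡ true → x ≡ true × y ≡ true
∧-true⁻ {true} e = refl , e

Layout⇒lpw : ∀ {G c} → Layout G ⊤ c → LpwAtMost G c
Layout⇒lpw {G} {c} ℒ = P , L , (λ u v a → layer ∈⊤ ∈⊤ a , layer ∈⊤ ∈⊤ (Adj-sym {G} a)) , narrow
  where
  open Layout ℒ
  inBag? : ∀ i v → Dec (l v ≤ i × i ≤ r v)
  inBag? i v = l v ≤? i ×-dec i ≤? r v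
  inBag : Fin (suc N) → V G → Bool
  inBag i v = does (inBag? (toℕ i) v)
  inBag⁻ : ∀ i {v} → inBag i v ≡ true → l v ≤ toℕ i × toℕ i ≤ r v
  inBag⁻ i {v} e = does⁻ (inBag? (toℕ i) v) e
  at : ∀ {i} → i ≤ N → Fin (suc N)
  at i≤N = fromℕ< (s≤s i≤N)
  inBag⁺ : ∀ {i v} (i≤N : i ≤ N) → l v ≤ i → i ≤ r v → inBag (at i≤N) v ≡ true
  inBag⁺ {i} {v} i≤N l≤i i≤r rewrite Fin.toℕ-fromℕ< (s≤s i≤N) = dec-true (inBag? i v) (l≤i , i≤r)
  l≤N : ∀ v → l v ≤ N
  l≤N v = ≤-trans (order ∈⊤) (bound ∈⊤)
  P : PathDecomposition G
  P = record
    { k = suc N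
    ; bag = inBag
    -- Overlapping intervals share the larger of their left ends.
    ; edgeCov = λ u v a → at (⊔-lub (l≤N u) (l≤N v)) ,
        inBag⁺ (⊔-lub (l≤N u) (l≤N v)) (m≤m⊔n _ _) (⊔-lub (order ∈⊤) (edge ∈⊤ ∈⊤ (Adj-sym {G} a))) ,
        inBag⁺ (⊔-lub (l≤N u) (l≤N v)) (m≤n⊔m _ _) (⊔-lub (edge ∈⊤ ∈⊤ a) (order ∈⊤))
    ; vertCov = λ v → at (l≤N v) , inBag⁺ (l≤N v) ≤-refl (order ∈⊤)
    ; interval = λ v i j m i≤j j≤m bi bm → dec-true (inBag? (toℕ j) v)
        (≤-trans (proj₁ (inBag⁻ i bi)) i≤j , ≤-trans j≤m (proj₂ (inBag⁻ m bm))) }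
  narrow : ∀ i j → count (λ v → inBag i v ∧ (L v ≡ᵇ j)) ≤ c
  narrow i j = ≤-trans (≤-reflexive (count-tabulate f)) (width (toℕ i) j (tabulate f) λ v∈ →
      case ∧-true⁻ (∈-tabulate⁻ f v∈) of λ { (b , e) →
        ∈⊤ , proj₁ (inBag⁻ i b) , proj₂ (inBag⁻ i b) , ≡ᵇ-true⁻ e })
    where
    f : V G → Bool
    f v = inBag i v ∧ (L v ≡ᵇ j)

-- Forests

module _ (H : Graph) (h₀ : V H) (forest : ¬ (Σ (Cycle H) λ C → ∀ i → vert C i ≢ h₀)) where

  -- A non-backtracking closed walk without repetitions is a cycle; take one of minimal length.
  walk-cycle : (w : ℕ → V H) → (∀ i → Adj H (w i) (w (suc i))) → (∀ i → w (suc (suc i)) ≢ w i) →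
               ∀ fuel i d → d ≤ fuel → w i ≡ w (suc d + i) →
               Σ (Cycle H) λ C → ∀ s → ∃ λ t → vert C s ≡ w t
  walk-cycle w adjacent turn fuel i zero d≤ e =
    contradiction (trans (≡-sym (subst (λ v → Adj H v (w (suc i))) e (adjacent i))) (loopless H _)) λ ()
  walk-cycle w adjacent turn fuel i (suc zero) d≤ e = ⊥-elim (turn i (≡-sym e))
  walk-cycle w adjacent turn (suc fuel) i (suc (suc d)) (s≤s d≤) e
    with any? (λ s → any? λ t → toℕ {suc (suc (suc d))} s <? toℕ {suc (suc (suc d))} t
                                ×-dec w (toℕ s + i) Fin.≟ w (toℕ t + i))
  ... | yes (s , t , s<t , e′) =
    walk-cycle w adjacent turn fuel (toℕ s + i) gap
      (≤-trans (s≤s⁻¹ (≤-trans (≤-trans (m≤m+n _ _) (≤-reflexive gap≡)) (s≤s⁻¹ (Fin.toℕ<n t)))) d≤)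
      (trans e′ (cong w (trans (cong (_+ i) (≡-sym gap≡)) (+-assoc (suc gap) (toℕ s) i))))
    where
    gap = toℕ t ∸ suc (toℕ s)
    gap≡ : suc gap + toℕ s ≡ toℕ t
    gap≡ = trans (≡-sym (+-suc gap (toℕ s))) (m∸n+n≡m s<t)
  ... | no ¬repeat = record
    { m = d ; vert = λ s → w (toℕ s + i)
    ; inj = λ {s} {t} e′ → injective s t e′
    ; consec = λ s → subst (λ x → Adj H (w (x + i)) (w (suc (toℕ s) + i))) (≡-sym (Fin.toℕ-inject₁ s))
                       (adjacent (toℕ s + i))
    ; close = subst₂ (λ x v → Adj H (w (x + i)) v) (≡-sym (Fin.toℕ-fromℕ (suc (suc d)))) (≡-sym e)
                (adjacent (suc (suc d) + i)) } , λ s → toℕ s + i , refl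
    where
    injective : ∀ s t → w (toℕ s + i) ≡ w (toℕ t + i) → s ≡ t
    injective s t e′ with <-cmp (toℕ s) (toℕ t)
    ... | tri< s<t _ _ = ⊥-elim (¬repeat (s , t , s<t , e′))
    ... | tri≈ _ s≡t _ = Fin.toℕ-injective s≡t
    ... | tri> _ _ t<s = ⊥-elim (¬repeat (t , s , t<s , ≡-sym e′))

  module _ {F : Subset (n H)} (h₀∉F : h₀ ∉ F)
           (onward : ∀ {h} → h ∈ F → ∀ prev → ∃ λ w → w ∈ F × Adj H h w × w ≢ prev) where

    private
      record Position : Set where
        field
          prev cur : V H
          cur∈F    : cur ∈ F
      open Position

      move : Position → Position
      move s with onward (cur∈F s) (prev s)
      ... | w , w∈F , _ = record { prev = cur s ; cur = w ; cur∈F = w∈F }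

      move-adj : ∀ s → Adj H (cur s) (cur (move s))
      move-adj s with onward (cur∈F s) (prev s)
      ... | _ , _ , a , _ = a

      move-turn : ∀ s → cur (move s) ≢ prev s
      move-turn s with onward (cur∈F s) (prev s)
      ... | _ , _ , _ , turn = turn

      prev-move : ∀ s → prev (move s) ≡ cur s
      prev-move s with onward (cur∈F s) (prev s)
      ... | _ = refl

      position : Position → ℕ → Position
      position s zero    = s
      position s (suc i) = move (position s i)

      start-at : Nonempty F → Position
      -- At the start there is no previous vertex; `h` itself stands in.
      start-at (h , h∈F) = record { prev = h ; cur = h ; cur∈F = h∈F }

    -- A walk that never turns back can continue in `F` for ever. By the pigeonhole principle it
    -- revisits a vertex, and the resulting cycle stays in `F`, away from `h₀`.
    no-leafless : ¬ Nonempty F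
    no-leafless ne with Fin.pigeonhole (n<1+n (n H)) (λ i → cur (position (start-at ne) (toℕ i)))
    ... | i , j , i<j , e = forest (proj₁ found , λ s e₀ → h₀∉F (subst (_∈ F)
            (trans (≡-sym (proj₂ (proj₂ found s))) e₀) (cur∈F (at (proj₁ (proj₂ found s))))))
      where
      at : ℕ → Position
      at = position (start-at ne)
      found : Σ (Cycle H) λ C → ∀ s → ∃ λ t → vert C s ≡ cur (at t)
      found = walk-cycle (cur ∘ at) (λ i → move-adj (at i))
        (λ i e → move-turn (move (at i)) (trans e (≡-sym (prev-move (at i)))))
        _ (toℕ i) (toℕ j ∸ suc (toℕ i)) ≤-refl
        (trans e (cong (cur ∘ at) (≡-sym (trans (≡-sym (+-suc _ (toℕ i))) (m∸n+n≡m i<j)))))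

  peelable : ∀ F → h₀ ∉ F → Peelable H F
  peelable F₀ = go ∣ F₀ ∣ F₀ ≤-refl
    where
    go : ∀ fuel F → ∣ F ∣ ≤ fuel → h₀ ∉ F → Peelable H F
    go fuel F size h₀∉F with any? (λ h → h ∈? F ×-dec all? λ h₁ → all? λ h₂ →
      h₁ ∈? F →-dec h₂ ∈? F →-dec Adj? {H} h h₁ →-dec Adj? {H} h h₂ →-dec h₁ Fin.≟ h₂)
    go zero F size h₀∉F | yes (h , h∈F , _) = ⊥-elim (n≮0 (≤-trans (x∈p⇒∣p-x∣<∣p∣ h∈F) size))
    go (suc fuel) F size h₀∉F | yes (h , h∈F , unique) = leaf h h∈F
      (go fuel (F - h) (s≤s⁻¹ (≤-trans (x∈p⇒∣p-x∣<∣p∣ h∈F) size)) (h₀∉F ∘ proj₁ ∘ ∈-⁻ F h))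
      (λ {h₁} {h₂} → unique h₁ h₂)
    go fuel F size h₀∉F | no ¬leaf = empty (no-leafless h₀∉F onward)
      where
      onward : ∀ {h} → h ∈ F → ∀ prev → ∃ λ w → w ∈ F × Adj H h w × w ≢ prev
      onward {h} h∈F prev with any? (λ w → w ∈? F ×-dec Adj? {H} h w ×-dec ¬? (w Fin.≟ prev))
      ... | yes found = found
      ... | no ¬found = ⊥-elim (¬leaf (h , h∈F , λ h₁ h₂ h₁∈ h₂∈ a₁ a₂ →
              trans (only h₁∈ a₁) (≡-sym (only h₂∈ a₂))))
        where
        only : ∀ {w} → w ∈ F → Adj H h w → w ≡ prev
        only {w} w∈ a = decidable-stable (w Fin.≟ prev) λ w≢ → ¬found (w , w∈ , a , w≢)

-- Apex ternary trees

-- Ternary heap numbering: the root is 0 and the children of `x` are 3x+1, 3x+2 and 3x+3.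
isParent : ℕ → ℕ → Bool
isParent x zero    = false
isParent x (suc y) = (y / 3) ≡ᵇ x

data Parent : ℕ → ℕ → Set where
  parent : ∀ {y} → Parent (y / 3) (suc y)

isParent⁺ : ∀ {x y} → Parent x y → isParent x y ≡ true
isParent⁺ (parent {y}) = ≡ᵇ-true⁺ {y / 3} refl

isParent⁻ : ∀ {x y} → isParent x y ≡ true → Parent x y
isParent⁻ {x} {suc y} e = subst (λ x → Parent x (suc y)) (≡ᵇ-true⁻ e) parent

Parent-< : ∀ {x y} → Parent x y → x < y
Parent-< (parent {y}) = s≤s (m/n≤m y 3)

Parent-unique : ∀ {x x′ y} → Parent x y → Parent x′ y → x ≡ x′
Parent-unique parent parent = refl

child : ℕ → Fin 3 → ℕ
child x j = suc (toℕ j + x * 3)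

Parent-child : ∀ x j → Parent x (child x j)
Parent-child x j = subst (λ y → Parent y (child x j)) (trans (+-distrib-/-∣ʳ (toℕ j) (n∣m*n x))
  (trans (cong (_+ x * 3 / 3) (m<n⇒m/n≡0 (Fin.toℕ<n j))) (m*n/n≡m x 3))) parent

child-injective : ∀ x {i j} → child x i ≡ child x j → i ≡ j
child-injective x e = Fin.toℕ-injective (+-cancelʳ-≡ (x * 3) _ _ (suc-injective e))

data Desc (x : ℕ) : ℕ → Set where
  self : Desc x x
  down : ∀ {y z} → Desc x y → Parent y z → Desc x z

Desc-≤ : ∀ {x y} → Desc x y → x ≤ y
Desc-≤ self       = ≤-refl
Desc-≤ (down d p) = ≤-trans (Desc-≤ d) (<⇒≤ (Parent-< p))

Desc-trans : ∀ {x y z} → Desc x y → Desc y z → Desc x z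
Desc-trans d self       = d
Desc-trans d (down e p) = down (Desc-trans d e) p

Desc-linear : ∀ {x x′ y} → Desc x y → Desc x′ y → Desc x x′ ⊎ Desc x′ x
Desc-linear self e = inj₂ e
Desc-linear (down d p) self = inj₁ (down d p)
Desc-linear (down d p) (down e q) with Parent-unique p q
... | refl = Desc-linear d e

Desc-child : ∀ x i j → Desc (child x i) (child x j) → i ≡ j
Desc-child x i j d = go refl d
  where
  go : ∀ {y} → y ≡ child x j → Desc (child x i) y → i ≡ j
  go e self       = child-injective x e
  go refl (down d p) with Parent-unique p (Parent-child x j)
  ... | refl = ⊥-elim (<⇒≱ (Parent-< (Parent-child x i)) (Desc-≤ d))

siblings-disjoint : ∀ x {i j y} → i ≢ j → Desc (child x i) y → ¬ Desc (child x j) y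
siblings-disjoint x {i} {j} i≢j d e with Desc-linear d e
... | inj₁ f = i≢j (Desc-child x i j f)
... | inj₂ f = i≢j (≡-sym (Desc-child x j i f))

-- The largest descendant of x at depth h.
last : ℕ → ℕ → ℕ
last x zero    = x
last x (suc h) = last (child x (suc (suc zero))) h

last-mono : ∀ {x y} h → x ≤ y → last x h ≤ last y h
last-mono zero    x≤y = x≤y
last-mono (suc h) x≤y = last-mono h (s≤s (+-monoʳ-≤ 2 (*-monoˡ-≤ 3 x≤y)))

≤-last : ∀ x h → x ≤ last x h
≤-last x zero    = ≤-refl
≤-last x (suc h) = ≤-trans (<⇒≤ (Parent-< (Parent-child x _))) (≤-last (child x _) h)

-- Lets the condition `last x h < N`, under which the complete tree of height `h` below `x` fits
-- into the first `N` nodes, pass to the children.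
last-child : ∀ x j h → last (child x j) h ≤ last x (suc h)
last-child x j h = last-mono h (s≤s (+-monoˡ-≤ (x * 3) (s≤s⁻¹ (Fin.toℕ<n j))))

apexTreeAdj : ∀ {N} → Fin (suc N) → Fin (suc N) → Bool
apexTreeAdj zero    zero    = false
apexTreeAdj zero    (suc _) = true
apexTreeAdj (suc _) zero    = true
apexTreeAdj (suc i) (suc j) = isParent (toℕ i) (toℕ j) ∨ isParent (toℕ j) (toℕ i)

-- The apex is zero, and suc i is the node i of the ternary tree in heap order.
apexTree : ℕ → Graph
apexTree N = record { n = suc N ; adj = apexTreeAdj ; sym = symmetric ; loopless = irreflexive }
  where
  symmetric : ∀ (u v : Fin (suc N)) → apexTreeAdj u v ≡ apexTreeAdj v u
  symmetric zero    zero    = refl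
  symmetric zero    (suc _) = refl
  symmetric (suc _) zero    = refl
  symmetric (suc i) (suc j) = Bool.∨-comm (isParent (toℕ i) (toℕ j)) _
  not-own : ∀ x → isParent x x ≡ false
  not-own x with isParent x x in e
  ... | true  = ⊥-elim (<-irrefl refl (Parent-< (isParent⁻ {x} {x} e)))
  ... | false = refl
  irreflexive : ∀ (v : Fin (suc N)) → apexTreeAdj v v ≡ false
  irreflexive zero    = refl
  irreflexive (suc i) rewrite not-own (toℕ i) = refl

cycle-neighbours : ∀ {G} (C : Cycle G) i → ∃ λ j → ∃ λ k →
                   j ≢ k × Adj G (vert C i) (vert C j) × Adj G (vert C i) (vert C k)
cycle-neighbours {G} C i with view i
... | ‵fromℕ = inject₁ (fromℕ _) , zero , (λ ()) , Adj-sym {G} (consec C (fromℕ _)) , close C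
... | ‵inject₁ zero = suc zero , fromℕ _ , (λ ()) , consec C zero , Adj-sym {G} (close C)
... | ‵inject₁ (suc j) = suc (suc j) , inject₁ (inject₁ j) ,
        (λ e → <-irrefl (trans (≡-sym (trans (Fin.toℕ-inject₁ (inject₁ j)) (Fin.toℕ-inject₁ j)))
                 (≡-sym (cong toℕ e))) (<-trans (n<1+n _) (n<1+n _))) ,
        consec C (suc j) , Adj-sym {G} (consec C (inject₁ j))

argmax : ∀ {m} (f : Fin (suc m) → ℕ) → ∃ λ i → ∀ j → f j ≤ f i
argmax {zero}  f = zero , λ { zero → ≤-refl }
argmax {suc m} f with argmax (f ∘ suc)
... | i , max with ≤-total (f zero) (f (suc i))
...   | inj₁ le = suc i , λ { zero → le ; (suc j) → max j }
...   | inj₂ ge = zero , λ { zero → ≤-refl ; (suc j) → ≤-trans (max j) ge }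

-- Both neighbours of the largest node of a cycle would be its parent.
apexTree-isApexForest : ∀ N → IsApexForest (apexTree N)
apexTree-isApexForest N = zero , λ { (C , avoid) → absurd C avoid }
  where
  smaller-parent : ∀ (u v : Fin (suc N)) → u ≢ zero → v ≢ zero → toℕ v ≤ toℕ u → Adj (apexTree N) u v →
           ∃ λ x → toℕ v ≡ suc x × Parent x (toℕ u ∸ 1)
  smaller-parent zero    v       u≢ v≢ le a = ⊥-elim (u≢ refl)
  smaller-parent (suc i) zero    u≢ v≢ le a = ⊥-elim (v≢ refl)
  smaller-parent (suc i) (suc j) u≢ v≢ le a with isParent (toℕ i) (toℕ j) in e
  ... | true  = ⊥-elim (<⇒≱ (Parent-< (isParent⁻ {toℕ i} e)) (s≤s⁻¹ le))
  ... | false = toℕ j , refl , isParent⁻ {toℕ j} a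
  absurd : (C : Cycle (apexTree N)) → (∀ i → vert C i ≢ zero) → _
  absurd C avoid with argmax (toℕ ∘ vert C)
  ... | i , max with cycle-neighbours C i
  ...   | j , k , j≢k , aj , ak
    with smaller-parent _ _ (avoid i) (avoid j) (max j) aj | smaller-parent _ _ (avoid i) (avoid k) (max k) ak
  ...   | x , ej , px | y , ek , py =
    j≢k (inj C (Fin.toℕ-injective (trans ej (trans (cong suc (Parent-unique px py)) (≡-sym ek)))))

-- Thick bags in path decompositions of apex trees

module _ {G : Graph} (P : PathDecomposition G) where

  -- A bag covering the first edge lies at or before `j`, and the rest of the walk starts from
  -- there, or at or after `j`, and then `u` itself is in bag `j`.
  walk-meets-bag : ∀ {U u v} → Reach G U u v → ∀ {i j m : Fin (k P)} → toℕ i ≤ toℕ j → toℕ j ≤ toℕ m →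
                   bag P i u ≡ true → bag P m v ≡ true → ∃ λ w → U w × bag P j w ≡ true
  walk-meets-bag (here s) i≤j j≤m bi bm = _ , s , interval P _ _ _ _ i≤j j≤m bi bm
  walk-meets-bag (step {u} {w} s a q) {i} {j} i≤j j≤m bi bm with edgeCov P u w a
  ... | e , be , be′ with ≤-total (toℕ e) (toℕ j)
  ...   | inj₁ e≤j = walk-meets-bag q e≤j j≤m be′ bm
  ...   | inj₂ j≤e = u , s , interval P u i j e i≤j j≤e bi be

median : (f : Fin 3 → ℕ) → ∃ λ a → ∃ λ b → ∃ λ c → a ≢ b × c ≢ b × f a ≤ f b × f b ≤ f c
median f with ≤-total (f zero) (f (suc zero)) | ≤-total (f (suc zero)) (f (suc (suc zero)))
            | ≤-total (f zero) (f (suc (suc zero)))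
... | inj₁ p | inj₁ q | _      = zero , suc zero , suc (suc zero) , (λ ()) , (λ ()) , p , q
... | inj₁ p | inj₂ q | inj₁ r = zero , suc (suc zero) , suc zero , (λ ()) , (λ ()) , r , q
... | inj₁ p | inj₂ q | inj₂ r = suc (suc zero) , zero , suc zero , (λ ()) , (λ ()) , r , p
... | inj₂ p | inj₁ q | inj₁ r = suc zero , zero , suc (suc zero) , (λ ()) , (λ ()) , p , r
... | inj₂ p | inj₁ q | inj₂ r = suc zero , suc (suc zero) , zero , (λ ()) , (λ ()) , q , r
... | inj₂ p | inj₂ q | _      = suc (suc zero) , suc zero , zero , (λ ()) , (λ ()) , q , p

module _ {N : ℕ} (P : PathDecomposition (apexTree N)) where

  private
    A = apexTree N

  Sub : ℕ → V A → Set
  Sub x v = ∃ λ i → v ≡ suc i × Desc x (toℕ i)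

  up : ∀ {x z U} (i iₓ : Fin N) → toℕ i ≡ z → toℕ iₓ ≡ x → Desc x z → (∀ v → Sub x v → U v) →
       Reach A U (suc i) (suc iₓ)
  up i iₓ refl eₓ self U⊇ with Fin.toℕ-injective eₓ
  ... | refl = here (U⊇ _ (i , refl , self))
  up {x} i iₓ refl eₓ (down {y} d p) U⊇ =
    step (U⊇ _ (i , refl , down d p)) adjacent (up iy iₓ ey eₓ d U⊇)
    where
    y<N = <-trans (Parent-< p) (Fin.toℕ<n i)
    iy = fromℕ< y<N
    ey = Fin.toℕ-fromℕ< y<N
    adjacent : Adj A (suc i) (suc iy)
    adjacent rewrite ey | isParent⁺ p = Bool.∨-zeroʳ _

  -- The subtrees at the first and the last of three children are joined through the root,
  -- hence meet the thick bag of the middle one.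
  thick-bag : ∀ h x → last x h < N →
              ∃ λ b → ∃ λ Q → (∀ {v} → v ∈ Q → bag P b v ≡ true × Sub x v) × h < ∣ Q ∣
  thick-bag zero x x<N with vertCov P (suc (fromℕ< x<N))
  ... | b , e = b , ⁅ v ⁆ ,
      (λ u∈ → subst (λ u → bag P b u ≡ true × Sub x u) (≡-sym (x∈⁅y⁆⇒x≡y v u∈))
        (e , fromℕ< x<N , refl , subst (Desc x) (≡-sym (Fin.toℕ-fromℕ< x<N)) self)) ,
      ≤-reflexive (≡-sym (∣⁅x⁆∣≡1 v))
    where v = suc (fromℕ< x<N)
  thick-bag (suc h) x lt = grow (median (λ j → toℕ (bagOf j)))
    where
    below : ∀ j → last (child x j) h < N
    below j = ≤-trans (s≤s (last-child x j h)) lt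
    sub : ∀ j → ∃ λ b → ∃ λ Q → (∀ {v} → v ∈ Q → bag P b v ≡ true × Sub (child x j) v) × h < ∣ Q ∣
    sub j = thick-bag h (child x j) (below j)
    bagOf : Fin 3 → Fin (k P)
    bagOf j = proj₁ (sub j)
    Q : Fin 3 → Subset (suc N)
    Q j = proj₁ (proj₂ (sub j))
    Q⊆ : ∀ j {v} → v ∈ Q j → bag P (bagOf j) v ≡ true × Sub (child x j) v
    Q⊆ j = proj₁ (proj₂ (proj₂ (sub j)))
    h<Q : ∀ j → h < ∣ Q j ∣
    h<Q j = proj₂ (proj₂ (proj₂ (sub j)))
    member : ∀ j → Nonempty (Q j)
    member j = decidable-stable (nonempty? (Q j)) λ ¬ne → n≮0 (≤-trans (h<Q j) (∣∅∣≤ ¬ne))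
    x<N = ≤-trans (s≤s (≤-last x (suc h))) lt
    root : Fin N
    root = fromℕ< x<N
    lift : ∀ j {v} → Sub (child x j) v → Sub x v
    lift j (i , e , d) = i , e , Desc-trans (down self (Parent-child x j)) d
    grow : (∃ λ a → ∃ λ b → ∃ λ c → a ≢ b × c ≢ b × toℕ (bagOf a) ≤ toℕ (bagOf b) ×
             toℕ (bagOf b) ≤ toℕ (bagOf c)) →
           ∃ λ b → ∃ λ Q → (∀ {v} → v ∈ Q → bag P b v ≡ true × Sub x v) × suc h < ∣ Q ∣
    grow (a , b , c , a≢b , c≢b , a≤b , b≤c)
      with walk-meets-bag P (Reach-trans (toRoot a a≢b _ (proj₂ (Q⊆ a (proj₂ (member a)))))
                              (Reach-sym (toRoot c c≢b _ (proj₂ (Q⊆ c (proj₂ (member c)))))))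
             a≤b b≤c (proj₁ (Q⊆ a (proj₂ (member a)))) (proj₁ (Q⊆ c (proj₂ (member c))))
      where
      -- The walk through the root avoids the middle subtree, so the vertex it leaves in the middle
      -- bag is not yet in `Q b`.
      U : V A → Set
      U v = Sub x v × ¬ Sub (child x b) v
      U-root : U (suc root)
      U-root = (root , refl , subst (Desc x) (≡-sym (Fin.toℕ-fromℕ< x<N)) self) ,
               λ { (_ , refl , d) → <⇒≱ (Parent-< (Parent-child x b))
                     (≤-trans (Desc-≤ d) (≤-reflexive (Fin.toℕ-fromℕ< x<N))) }
      toRoot : ∀ j → j ≢ b → ∀ v → Sub (child x j) v → Reach A U v (suc root)
      toRoot j j≢b _ (i , refl , d) = Reach-trans
          (up i iⱼ refl eⱼ d U⊇)
          (step (U⊇ _ (iⱼ , refl , subst (Desc (child x j)) (≡-sym eⱼ) self)) adjacent (here U-root))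
        where
        U⊇ : ∀ v → Sub (child x j) v → U v
        U⊇ v (i , e , d) = lift j (i , e , d) ,
          λ { (i′ , e′ , d′) → siblings-disjoint x j≢b d (subst (λ i → Desc (child x b) (toℕ i))
                                 (Fin.suc-injective (trans (≡-sym e′) e)) d′) }
        j<N = ≤-trans (s≤s (≤-last (child x j) h)) (below j)
        iⱼ = fromℕ< j<N
        eⱼ = Fin.toℕ-fromℕ< j<N
        adjacent : Adj A (suc iⱼ) (suc root)
        adjacent rewrite Fin.toℕ-fromℕ< x<N | eⱼ | isParent⁺ (Parent-child x j) = Bool.∨-zeroʳ _
    ... | w , (w∈x , w∉b) , bw = bagOf b , Q b ∪ ⁅ w ⁆ ,
        (λ v∈ → [ (λ v∈Q → proj₁ (Q⊆ b v∈Q) , lift b (proj₂ (Q⊆ b v∈Q)))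
                , (λ v∈w → subst (λ v → bag P (bagOf b) v ≡ true × Sub x v)
                             (≡-sym (x∈⁅y⁆⇒x≡y w v∈w)) (bw , w∈x)) ]′ (x∈p∪q⁻ (Q b) _ v∈)) ,
        ≤-trans (s≤s (h<Q b)) (p⊂q⇒∣p∣<∣q∣
          (⊂-intro (p⊆p∪q _) (∈-∪⁅⁆ (Q b) w) (w∉b ∘ proj₂ ∘ Q⊆ b)))

apexTree-wide : ∀ c → ¬ LpwAtMost (apexTree (suc (last 0 (c + (c + c))))) c
apexTree-wide c (P , L , layering , narrow) with thick-bag P (c + (c + c)) 0 ≤-refl
... | b , Q , Q⊆ , big = <⇒≱ big (≤-trans (p⊆q⇒∣p∣≤∣q∣ Q⊆layers)
        (≤-trans (∣∪∣≤ (slice (ℓ ∸ 1)) _) (+-mono-≤ (slice≤ (ℓ ∸ 1))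
          (≤-trans (∣∪∣≤ (slice ℓ) _) (+-mono-≤ (slice≤ ℓ) (slice≤ (suc ℓ)))))))
  where
  ℓ = L zero
  inSlice : ℕ → _ → Bool
  inSlice j v = bag P b v ∧ (L v ≡ᵇ j)
  slice : ℕ → Subset _
  slice j = tabulate (inSlice j)
  slice≤ : ∀ j → ∣ slice j ∣ ≤ c
  slice≤ j = ≤-trans (≤-reflexive (≡-sym (count-tabulate (inSlice j)))) (narrow b j)
  ∈-slice : ∀ {j v} → bag P b v ≡ true → L v ≡ j → v ∈ slice j
  ∈-slice {j} {v} e refl = ∈-tabulate⁺ (inSlice j) (trans (cong (_∧ (L v ≡ᵇ L v)) e) (≡ᵇ-true⁺ {L v} refl))
  -- If `ℓ` is 0, the truncated `ℓ ∸ 1` merely repeats layer 0, and no node lies below it.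
  Q⊆layers : Q ⊆ slice (ℓ ∸ 1) ∪ (slice ℓ ∪ slice (suc ℓ))
  Q⊆layers v∈ with Q⊆ v∈
  ... | bv , i , refl , _ with layering zero (suc i) refl | <-cmp (L (suc i)) ℓ
  ...   | ℓ≤ , _ | tri< lt _ _ = p⊆p∪q _ (∈-slice bv
              (cong (_∸ 1) (≤-antisym lt ℓ≤)))
  ...   | _ | tri≈ _ e _ = q⊆p∪q (slice (ℓ ∸ 1)) _ (p⊆p∪q _ (∈-slice bv e))
  ...   | _ , ≤ℓ | tri> _ _ gt = q⊆p∪q (slice (ℓ ∸ 1)) _ (q⊆p∪q (slice ℓ) _ (∈-slice bv (≤-antisym ≤ℓ gt)))

theorem4 : (𝒢 : Graph → Set) → MinorClosed 𝒢 →
    (BoundedLayeredPathwidth 𝒢 ⇔ Σ Graph (λ G → IsApexForest G × ¬ 𝒢 G))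
theorem4 𝒢 closed = mk⇔ bounded⇒excluded excluded⇒bounded
  where
  bounded⇒excluded : BoundedLayeredPathwidth 𝒢 → Σ Graph (λ G → IsApexForest G × ¬ 𝒢 G)
  bounded⇒excluded (c , lpw≤c) =
    A , apexTree-isApexForest _ , λ A∈𝒢 → apexTree-wide c (lpw≤c A A∈𝒢)
    where A = apexTree (suc (last 0 (c + (c + c))))
  excluded⇒bounded : Σ Graph (λ G → IsApexForest G × ¬ 𝒢 G) → BoundedLayeredPathwidth 𝒢
  excluded⇒bounded (H , (h₀ , forest) , H∉𝒢) = n H + (n H + n H) , λ G G∈𝒢 →
    Layout⇒lpw (layout G (peelable H h₀ forest (∁ ⁅ h₀ ⁆) (λ h₀∈ → x∈∁p⇒x∉p h₀∈ (x∈⁅x⁆ h₀)))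
      λ H≼G → H∉𝒢 (closed G H G∈𝒢 H≼G))
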